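{- For any proper cellular pseudomanifold $M$, the poset $M/\!\!\sim$ is a primitive cellular pseudomanifold with $e(M/\!\!\sim)=e(M)$.
   Context: A finite lattice $(X,<)$ is ranked if there is $\rho:X\to\mathbb N$ such that for each $x$ every maximal chain from $\mathbf 0$ to $x$ has length $\rho(x)$. For a ranked lattice $L$ with top $\mathbf 1$, $\Lambda(L)$ is the graph on the elements of rank $\rho(\mathbf 1)-1$, with $\sigma\ne\gamma$ adjacent iff $\rho(\sigma\wedge\gamma)=\rho(\mathbf 1)-2$. A cellular pseudomanifold is a finite ranked lattice $M$ such that for all $x<z$: if $\rho(z)=\rho(x)+2$ there are exactly two $y$ with $x<y<z$, and if $\rho(z)>\rho(x)+2$ then $\Lambda([x,z])$ is connected. Faces are its elements, $\dim f=\rho(f)-1$, $\dim M=\rho(\mathbf 1)-2$; vertices are faces of dimension $0$. The shadow of a face is the set of vertices below it; faces are identified with shadows. The excess $e(M)$ is $n-d-2$ for $n$ vertices and dimension $d$. For vertices $x,y$, $x\sim y$ iff $x=y$ or the transposition of $x$ and $y$ (fixing all other vertices) induces an automorphism of $M$; this is an equivalence relation. $M$ is proper if every $\sim$-equivalence class is the shadow of a face, and primitive if all $\sim$-classes are singletons. For proper $M$, $M/\!\!\sim$ is the poset, ordered by inclusion, whose elements are the sets $\{X_1,\dots,X_t\}$ of $\sim$-equivalence classes of $M$ such that $X_1\cup\dots\cup X_t$ is the shadow of a face of $M$. -}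

module Defs where

open import Level using (Level; 0ℓ; _⊔_) renaming (suc to lsuc)
open import Data.Nat as ℕ using (ℕ; zero; suc; _∸_)
open import Data.Integer as ℤ using (ℤ; +_)
open import Data.List using (List; length)
open import Data.List.Relation.Unary.Any using (Any)
open import Data.List.Relation.Unary.All using (All)
open import Data.List.Relation.Unary.AllPairs using (AllPairs)
open import Data.Product using (Σ; ∃; _×_; _,_; proj₁; proj₂)
open import Data.Sum using (_⊎_)
open import Relation.Nullary using (¬_)
open import Relation.Unary using (Pred)
open import Relation.Binary using (Poset; Rel; IsEquivalence; IsPreorder; IsPartialOrder)
open import Relation.Binary.PropositionalEquality using (_≡_)
open import Relation.Binary.Lattice using (IsLattice)
open import Algebra.Core using (Op₂)
open import Function.Bundles using (_⇔_; mk⇔; Equivalence)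
import Function.Properties.Equivalence as ⇔

module PosetNotions {c ℓ₁ ℓ₂} (P : Poset c ℓ₁ ℓ₂) where
  open Poset P using (Carrier; _≈_; _≤_)

  _<_ : Rel Carrier (ℓ₁ ⊔ ℓ₂)
  x < y = x ≤ y × ¬ (x ≈ y)

  _⋖_ : Rel Carrier (c ⊔ ℓ₁ ⊔ ℓ₂)
  x ⋖ y = x < y × (∀ z → ¬ (x < z × z < y))

  data MaxChain : Carrier → Carrier → ℕ → Set (c ⊔ ℓ₁ ⊔ ℓ₂) where
    done : ∀ {a b} → a ≈ b → MaxChain a b zero
    step : ∀ {a m b k} → a ⋖ m → MaxChain m b k → MaxChain a b (suc k)

  Finite : Set (c ⊔ ℓ₁)
  Finite = Σ (List Carrier) λ xs → ∀ x → Any (x ≈_) xs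

  IsLeast : Carrier → Set (c ⊔ ℓ₂)
  IsLeast b = ∀ x → b ≤ x

  IsGreatest : Carrier → Set (c ⊔ ℓ₂)
  IsGreatest t = ∀ x → x ≤ t

  data Walk {ℓ ℓ'} (N : Pred Carrier ℓ) (A : Rel Carrier ℓ') :
            Carrier → Carrier → Set (c ⊔ ℓ₁ ⊔ ℓ ⊔ ℓ') where
    here : ∀ {a b} → a ≈ b → Walk N A a b
    step : ∀ {a b d} → N b → A a b → Walk N A b d → Walk N A a d

  Connected : ∀ {ℓ ℓ'} → Pred Carrier ℓ → Rel Carrier ℓ' → Set (c ⊔ ℓ₁ ⊔ ℓ ⊔ ℓ')
  Connected N A = ∀ σ γ → N σ → N γ → Walk N A σ γ

  ExactlyTwoBetween : Carrier → Carrier → Set (c ⊔ ℓ₁ ⊔ ℓ₂)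
  ExactlyTwoBetween x z =
    Σ Carrier λ y₁ → Σ Carrier λ y₂ →
      (x < y₁ × y₁ < z) × (x < y₂ × y₂ < z) × ¬ (y₁ ≈ y₂) ×
      (∀ y → x < y → y < z → (y ≈ y₁) ⊎ (y ≈ y₂))

record IsCPM {c ℓ₁ ℓ₂} (P : Poset c ℓ₁ ℓ₂) : Set (lsuc (c ⊔ ℓ₁ ⊔ ℓ₂)) where
  open Poset P using (Carrier; _≈_; _≤_)
  open PosetNotions P
  field
    finite     : Finite
    _∨_ _∧_    : Op₂ Carrier
    isLattice  : IsLattice _≈_ _≤_ _∨_ _∧_
    𝟎 𝟏        : Carrier
    𝟎-least    : IsLeast 𝟎
    𝟏-greatest : IsGreatest 𝟏
    ρ          : Carrier → ℕ
    ranked     : ∀ x k → MaxChain 𝟎 x k → ρ x ≡ k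

  -- Λ([x,z]): nodes are the elements of [x,z] of rank ρ z - 1
  -- (the coatoms of the interval); σ ≠ γ are adjacent iff
  -- ρ(σ ∧ γ) = ρ z - 2 (ranks in [x,z] are ρ - ρ x, and the meet in
  -- [x,z] is the meet in P).
  ΛNode : Carrier → Carrier → Pred Carrier ℓ₂
  ΛNode x z y = x ≤ y × y ≤ z × ρ y ≡ ρ z ∸ 1

  ΛAdj : Carrier → Rel Carrier ℓ₁
  ΛAdj z σ γ = ¬ (σ ≈ γ) × ρ (σ ∧ γ) ≡ ρ z ∸ 2

  field
    diamond   : ∀ x z → x < z → ρ z ≡ 2 ℕ.+ ρ x → ExactlyTwoBetween x z
    connected : ∀ x z → x < z → 2 ℕ.+ ρ x ℕ.< ρ z → Connected (ΛNode x z) (ΛAdj z)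

  dimF : Carrier → ℤ
  dimF f = + ρ f ℤ.- + 1

  dim : ℤ
  dim = + ρ 𝟏 ℤ.- + 2

  IsVertex : Pred Carrier 0ℓ
  IsVertex x = dimF x ≡ + 0

  NumVertices : ℕ → Set (c ⊔ ℓ₁)
  NumVertices n = Σ (List Carrier) λ vs →
    length vs ≡ n × All IsVertex vs × AllPairs (λ a b → ¬ (a ≈ b)) vs ×
    (∀ v → IsVertex v → Any (v ≈_) vs)

  -- excess e(P) = n - d - 2, where n is the number of vertices
  excess : ℕ → ℤ
  excess n = + n ℤ.- dim ℤ.- + 2

  IsAutomorphism : (Carrier → Carrier) → Set (c ⊔ ℓ₁ ⊔ ℓ₂)
  IsAutomorphism φ = (∀ a b → a ≤ b ⇔ φ a ≤ φ b) × (∀ b → Σ Carrier λ a → φ a ≈ b)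

  ActsAsTransposition : (Carrier → Carrier) → Carrier → Carrier → Set (c ⊔ ℓ₁)
  ActsAsTransposition φ x y =
    φ x ≈ y × φ y ≈ x × (∀ v → IsVertex v → ¬ (v ≈ x) → ¬ (v ≈ y) → φ v ≈ v)

  _∼_ : Carrier → Carrier → Set (c ⊔ ℓ₁ ⊔ ℓ₂)
  x ∼ y = x ≈ y ⊎ Σ (Carrier → Carrier) λ φ → IsAutomorphism φ × ActsAsTransposition φ x y

  Shadow : Carrier → Pred Carrier ℓ₂
  Shadow f v = IsVertex v × v ≤ f

  Class : Carrier → Pred Carrier (c ⊔ ℓ₁ ⊔ ℓ₂)
  Class x v = IsVertex v × x ∼ v

  Proper : Set (c ⊔ ℓ₁ ⊔ ℓ₂)
  Proper = ∀ x → IsVertex x → Σ Carrier λ f → ∀ v → Class x v ⇔ Shadow f v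

  Primitive : Set (c ⊔ ℓ₁ ⊔ ℓ₂)
  Primitive = ∀ x y → IsVertex x → IsVertex y → x ∼ y → x ≈ y

module Quotient (M : Poset 0ℓ 0ℓ 0ℓ) (cM : IsCPM M) where
  open Poset M using (Carrier; _≈_; _≤_)
  open IsCPM cM

  -- An element {X₁,…,X_t} of M/∼ (a set of ∼-classes) is represented by
  -- the union D = X₁ ∪ … ∪ X_t: a set of vertices that is a union of
  -- ∼-classes (i.e. ∼-saturated) and is the shadow of a face of M.
  -- The class [v] belongs to the set iff v ∈ D.
  record QElem : Set₁ where
    field
      D          : Pred Carrier 0ℓ
      saturated  : ∀ v w → D v → IsVertex w → v ∼ w → D w
      isShadow   : Σ Carrier λ f → ∀ v → D v ⇔ Shadow f v
  open QElem

  _≈Q_ : Rel QElem 0ℓ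
  A ≈Q B = ∀ v → D A v ⇔ D B v

  _≤Q_ : Rel QElem 0ℓ
  A ≤Q B = ∀ v → D A v → D B v

  private
    isEqQ : IsEquivalence _≈Q_
    isEqQ = record
      { refl  = λ v → ⇔.refl
      ; sym   = λ p v → ⇔.sym (p v)
      ; trans = λ p q v → ⇔.trans (p v) (q v)
      }

  isPartialOrderQ : IsPartialOrder _≈Q_ _≤Q_
  isPartialOrderQ = record
    { isPreorder = record
      { isEquivalence = isEqQ
      ; reflexive     = λ p v → Equivalence.to (p v)
      ; trans         = λ p q v x → q v (p v x)
      }
    ; antisym = λ p q v → mk⇔ (p v) (q v)
    }

  M/∼ : Poset (lsuc 0ℓ) 0ℓ 0ℓ
  M/∼ = record
    { Carrier        = QElem
    ; _≈_            = _≈Q_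
    ; _≤_            = _≤Q_
    ; isPartialOrder = isPartialOrderQ
    }

_/∼ : (M : Poset 0ℓ 0ℓ 0ℓ) → IsCPM M → Poset (lsuc 0ℓ) 0ℓ 0ℓ
_/∼ M cM = Quotient.M/∼ M cM

{-# OPTIONS --safe #-}
module Submission where

-- In any cellular pseudomanifold, if x ≠ y are vertices interchanged by an automorphism that
-- fixes all other vertices, then (by walking in Λ([𝟎,H])) every coatom of a face H ∋ x, y
-- contains x or y; it follows that A ∪ {x} is a face of rank ρ(A) + 1 whenever A is a face
-- containing neither x nor y.  Choose one representative in every ∼-class of M and let N be the
-- set of all other vertices.  Adding vertices one at a time, N and all A ∪ N with A a saturated
-- face are faces, and ρ(N) = |N|.  Hence A ↦ A ∪ N is an isomorphism of M/∼ onto the interval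
-- [N,𝟏], whose inverse sends a face to the union of the classes it contains; so M/∼ is a
-- cellular pseudomanifold, with |N| fewer vertices than M and rank smaller by |N|.  The same
-- argument shows that a set of vertices is a face of M iff the union of the classes contained in
-- it is one.  So if an automorphism of M/∼ interchanged two classes and fixed the others, the
-- transposition of a vertex in one with a vertex in the other would be an automorphism of M.
--
-- The order of M is not assumed decidable.  It is so up to double negation, and properness makes
-- "v ≤ f" decidable for vertices v, which is all that the quotient sees of M.

open import Defs
open import Level using (0ℓ; _⊔_)
open import Data.Nat as ℕ using (ℕ; zero; suc; _∸_; s≤s; z≤n)
import Data.Nat.Properties as ℕ
open import Data.Integer as ℤ using (+_)
import Data.Integer.Properties as ℤ
open import Data.Integer.Solver using (module +-*-Solver)
open import Data.Fin using (zero; suc)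
open import Data.Fin.Properties using (injective⇒≤)
open import Data.List using (List; []; _∷_; foldr; map; length; filter; lookup)
open import Data.List.Properties using (length-map)
open import Data.List.Relation.Unary.Any as Any using (Any; here; there)
import Data.List.Relation.Unary.Any.Properties as Any
open import Data.List.Relation.Unary.All as All using (All; []; _∷_)
open import Data.List.Relation.Unary.AllPairs using (AllPairs; []; _∷_)
import Data.List.Relation.Unary.AllPairs.Properties as AllPairs
open import Data.List.Membership.Propositional using (_∈_; find; lose)
open import Data.List.Membership.Propositional.Properties using (∈-map⁺; ∈-map⁻; ∈-filter⁺; ∈-filter⁻; ∈-lookup)
open import Data.Product using (Σ; ∃; _×_; _,_; proj₁; proj₂)
open import Data.Sum as ⊎ using (_⊎_; inj₁; inj₂)
open import Data.Empty using (⊥; ⊥-elim)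
open import Function.Base using (_∘_; case_of_; id)
open import Function.Bundles using (_⇔_; mk⇔; Equivalence)
open import Relation.Binary using (Poset; Setoid)
open import Relation.Binary.Lattice using (IsLattice)
open import Relation.Binary.PropositionalEquality as ≡ using (_≡_)
open import Relation.Nullary using (¬_; Dec; yes; no)
open import Relation.Nullary.Decidable using (_×-dec_; _⊎-dec_; _→-dec_; ¬?; ¬¬-excluded-middle; map′; decidable-stable)

-- Facts about cellular pseudomanifolds that do not require deciding the order.

module CPMBasics {c ℓ₁ ℓ₂} (P : Poset c ℓ₁ ℓ₂) (cP : IsCPM P) where
  open Poset P using (Carrier; _≈_; _≤_; refl; reflexive; trans; antisym; module Eq)
  open IsCPM cP
  open IsLattice isLattice using (x≤x∨y; y≤x∨y; ∨-least)

  vertex⇒ρ : ∀ {v} → IsVertex v → ρ v ≡ 1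
  vertex⇒ρ {v} eq = ℤ.+-injective (ℤ.i-j≡0⇒i≡j (+ ρ v) (+ 1) eq)

  ρ⇒vertex : ∀ {v} → ρ v ≡ 1 → IsVertex v
  ρ⇒vertex {v} eq = ℤ.i≡j⇒i-j≡0 (≡.cong +_ eq)

  vertex? : ∀ v → Dec (IsVertex v)
  vertex? v = map′ ρ⇒vertex vertex⇒ρ (ρ v ℕ.≟ 1)

  ∨-assoc : ∀ x y z → x ∨ (y ∨ z) ≈ (x ∨ y) ∨ z
  ∨-assoc x y z = antisym
    (∨-least (trans (x≤x∨y x y) (x≤x∨y _ z)) (∨-least (trans (y≤x∨y x y) (x≤x∨y _ z)) (y≤x∨y _ z)))
    (∨-least (∨-least (x≤x∨y x _) (trans (x≤x∨y y z) (y≤x∨y x _))) (trans (y≤x∨y y z) (y≤x∨y x _)))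

  ⋁ : List Carrier → Carrier
  ⋁ = foldr _∨_ 𝟎

  ⋁-upper : ∀ {x xs} → x ∈ xs → x ≤ ⋁ xs
  ⋁-upper (here ≡.refl) = x≤x∨y _ _
  ⋁-upper (there p) = trans (⋁-upper p) (y≤x∨y _ _)

  ⋁-least : ∀ {z} xs → (∀ {x} → x ∈ xs → x ≤ z) → ⋁ xs ≤ z
  ⋁-least []       _  = 𝟎-least _
  ⋁-least (x ∷ xs) ub = ∨-least (ub (here ≡.refl)) (⋁-least xs (ub ∘ there))

  automorphism-cong : ∀ {φ} → IsAutomorphism φ → ∀ {a b} → a ≈ b → φ a ≈ φ b
  automorphism-cong (order , _) e = antisym
    (Equivalence.to (order _ _) (reflexive e))
    (Equivalence.to (order _ _) (reflexive (Eq.sym e)))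

  automorphism-∘ : ∀ {φ ψ} → IsAutomorphism φ → IsAutomorphism ψ → IsAutomorphism (φ ∘ ψ)
  automorphism-∘ {φ} {ψ} autφ@(orderφ , surjφ) (orderψ , surjψ) =
    (λ a b → mk⇔ (Equivalence.to (orderφ _ _) ∘ Equivalence.to (orderψ a b))
                 (Equivalence.from (orderψ a b) ∘ Equivalence.from (orderφ _ _))) ,
    λ b → let d , φd≈b = surjφ b
              a , ψa≈d = surjψ d
          in a , Eq.trans (automorphism-cong autφ ψa≈d) φd≈b

  transposition-sym : ∀ {φ x y} → ActsAsTransposition φ x y → ActsAsTransposition φ y x
  transposition-sym (φx , φy , fix) = φy , φx , λ v vv v≉y v≉x → fix v vv v≉x v≉y

  ∼-sym : ∀ {x y} → x ∼ y → y ∼ x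
  ∼-sym (inj₁ x≈y) = inj₁ (Eq.sym x≈y)
  ∼-sym (inj₂ (φ , aut , act)) = inj₂ (φ , aut , transposition-sym {φ} act)

  ∼-respˡ : ∀ {x x′ y} → x ≈ x′ → x ∼ y → x′ ∼ y
  ∼-respˡ e (inj₁ x≈y) = inj₁ (Eq.trans (Eq.sym e) x≈y)
  ∼-respˡ e (inj₂ (φ , aut , φx , φy , fix)) = inj₂ (φ , aut ,
    Eq.trans (automorphism-cong aut (Eq.sym e)) φx , Eq.trans φy e ,
    λ v vv v≉x′ → fix v vv λ v≈x → v≉x′ (Eq.trans v≈x e))

  private
    ¬¬-all : ∀ {a p} {A : Set a} {Q : A → Set p} → (∀ x → ¬ ¬ Q x) → (xs : List A) →
             ¬ ¬ (∀ {z} → z ∈ xs → Q z)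
    ¬¬-all q []       k = k λ ()
    ¬¬-all q (x ∷ xs) k = q x λ qx → ¬¬-all q xs λ qs →
      k λ { (here ≡.refl) → qx ; (there p) → qs p }

  -- Excluded middle is used only for the finitely many pairs of listed elements, and finitely many
  -- double negations combine into one; every other pair is equal to a listed one.
  ¬¬-decidable : ¬ ¬ (∀ x y → Dec (x ≤ y))
  ¬¬-decidable k =
    ¬¬-all (λ a → ¬¬-all (λ b → ¬¬-excluded-middle {A = a ≤ b}) elems) elems λ dec →
    k λ x y →
      let a , a∈ , x≈a = find (proj₂ finite x)
          b , b∈ , y≈b = find (proj₂ finite y)
      in map′ (λ a≤b → trans (reflexive x≈a) (trans a≤b (reflexive (Eq.sym y≈b))))
              (λ x≤y → trans (reflexive (Eq.sym x≈a)) (trans x≤y (reflexive y≈b)))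
              (dec a∈ b∈)
    where elems = proj₁ finite

-- Cellular pseudomanifolds with a decidable order: ranks and atoms.

module DecidableCPM {c ℓ₁ ℓ₂} (P : Poset c ℓ₁ ℓ₂) (cP : IsCPM P)
                    (_≤?_ : ∀ x y → Dec (Poset._≤_ P x y)) where
  open Poset P using (Carrier; _≈_; _≤_; refl; reflexive; trans; antisym; module Eq)
  open PosetNotions P
  open IsCPM cP
  open IsLattice isLattice using (x≤x∨y; y≤x∨y; ∨-least; x∧y≤x; x∧y≤y; ∧-greatest)
  open CPMBasics P cP

  _≈?_ : ∀ x y → Dec (x ≈ y)
  x ≈? y = map′ (λ (p , q) → antisym p q) (λ e → reflexive e , reflexive (Eq.sym e))
                ((x ≤? y) ×-dec (y ≤? x))

  _<?_ : ∀ x y → Dec (x < y)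
  x <? y = (x ≤? y) ×-dec ¬? (x ≈? y)

  ≤∧≰⇒< : ∀ {x y} → x ≤ y → ¬ (y ≤ x) → x < y
  ≤∧≰⇒< x≤y y≰x = x≤y , λ e → y≰x (reflexive (Eq.sym e))

  <⇒≱ : ∀ {x y} → x < y → ¬ (y ≤ x)
  <⇒≱ (x≤y , x≉y) y≤x = x≉y (antisym x≤y y≤x)

  <-respˡ : ∀ {x x′ y} → x ≈ x′ → x < y → x′ < y
  <-respˡ e (x≤y , x≉y) = trans (reflexive (Eq.sym e)) x≤y , λ e′ → x≉y (Eq.trans e e′)

  <-respʳ : ∀ {x y y′} → y ≈ y′ → x < y → x < y′
  <-respʳ e (x≤y , x≉y) = trans x≤y (reflexive e) , λ e′ → x≉y (Eq.trans e′ (Eq.sym e))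

  ≤-<-trans : ∀ {x y z} → x ≤ y → y < z → x < z
  ≤-<-trans x≤y y<z = ≤∧≰⇒< (trans x≤y (proj₁ y<z)) λ z≤x → <⇒≱ y<z (trans z≤x x≤y)

  private
    count : Carrier → List Carrier → ℕ
    count p [] = 0
    count p (y ∷ ys) with y ≤? p
    ... | yes _ = suc (count p ys)
    ... | no  _ = count p ys

    count-mono : ∀ {p q} ys → p ≤ q → count p ys ℕ.≤ count q ys
    count-mono [] p≤q = z≤n
    count-mono {p} {q} (y ∷ ys) p≤q with y ≤? p | y ≤? q
    ... | yes _ | yes _ = s≤s (count-mono ys p≤q)
    ... | yes y≤p | no y≰q = ⊥-elim (y≰q (trans y≤p p≤q))
    ... | no _ | yes _ = ℕ.m≤n⇒m≤1+n (count-mono ys p≤q)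
    ... | no _ | no _ = count-mono ys p≤q

    count-strict : ∀ {p q ys} → p < q → Any (q ≈_) ys → count p ys ℕ.< count q ys
    count-strict {p} {q} {y ∷ ys} p<q (here q≈y) with y ≤? p | y ≤? q
    ... | yes y≤p | _ = ⊥-elim (<⇒≱ p<q (trans (reflexive q≈y) y≤p))
    ... | no _ | yes _ = s≤s (count-mono ys (proj₁ p<q))
    ... | no _ | no y≰q = ⊥-elim (y≰q (reflexive (Eq.sym q≈y)))
    count-strict {p} {q} {y ∷ ys} p<q (there i) with y ≤? p | y ≤? q
    ... | yes _ | yes _ = s≤s (count-strict p<q i)
    ... | yes y≤p | no y≰q = ⊥-elim (y≰q (trans y≤p (proj₁ p<q)))
    ... | no _ | yes _ = ℕ.m≤n⇒m≤1+n (count-strict p<q i)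
    ... | no _ | no _ = count-strict p<q i

    -- A strictly monotone measure for recursion along the order, available before `ρ` is known to
    -- be monotone.
    height : Carrier → ℕ
    height x = count x (proj₁ finite)

    height-< : ∀ {x y} → x < y → height x ℕ.< height y
    height-< x<y = count-strict x<y (proj₂ finite _)

    between? : ∀ x z → Dec (∃ λ y → x < y × y < z)
    between? x z with Any.any? (λ y → (x <? y) ×-dec (y <? z)) (proj₁ finite)
    ... | yes p = yes (Any.satisfied p)
    ... | no ¬p = no λ (y , x<y , y<z) →
      ¬p (Any.map (λ e → <-respʳ e x<y , <-respˡ e y<z) (proj₂ finite y))

    coatom-rec : ∀ n x z → height z ∸ height x ℕ.< n → x < z → ∃ λ f → x ≤ f × f ⋖ z
    coatom-rec (suc n) x z (s≤s le) x<z with between? x z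
    ... | no ¬b = x , refl , x<z , λ y b → ¬b (y , b)
    ... | yes (y , x<y , y<z) =
      let f , y≤f , f⋖z = coatom-rec n y z
            (ℕ.<-≤-trans (ℕ.∸-monoʳ-< (height-< x<y) (ℕ.<⇒≤ (height-< y<z))) le) y<z
      in f , trans (proj₁ x<y) y≤f , f⋖z

  coatom-above : ∀ {x z} → x < z → ∃ λ f → x ≤ f × f ⋖ z
  coatom-above x<z = coatom-rec _ _ _ (ℕ.n<1+n _) x<z

  ⋖-respˡ : ∀ {x x′ y} → x ≈ x′ → x ⋖ y → x′ ⋖ y
  ⋖-respˡ e (x<y , nb) = <-respˡ e x<y , λ z (p , q) → nb z (<-respˡ (Eq.sym e) p , q)

  chain-snoc : ∀ {a b d k} → MaxChain a b k → b ⋖ d → MaxChain a d (suc k)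
  chain-snoc (done a≈b)  b⋖d = step (⋖-respˡ (Eq.sym a≈b) b⋖d) (done Eq.refl)
  chain-snoc (step p ch) b⋖d = step p (chain-snoc ch b⋖d)

  chain-respʳ : ∀ {a b d k} → MaxChain a b k → b ≈ d → MaxChain a d k
  chain-respʳ (done a≈b)  b≈d = done (Eq.trans a≈b b≈d)
  chain-respʳ (step p ch) b≈d = step p (chain-respʳ ch b≈d)

  private
    chain-rec : ∀ n x → height x ℕ.< n → ∃ λ k → MaxChain 𝟎 x k
    chain-rec (suc n) x (s≤s le) with 𝟎 ≈? x
    ... | yes e = 0 , done e
    ... | no ne =
      let f , _ , f⋖x = coatom-above (𝟎-least x , ne)
          k , ch = chain-rec n f (ℕ.<-≤-trans (height-< (proj₁ f⋖x)) le)
      in suc k , chain-snoc ch f⋖x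

  -- The axiom `ranked` constrains `ρ` only through maximal chains that exist. Descending through
  -- coatoms supplies one for every element, and all properties of `ρ` below rest on this.
  chain : ∀ x → ∃ λ k → MaxChain 𝟎 x k
  chain x = chain-rec _ x (ℕ.n<1+n _)

  ρ-cong : ∀ {x y} → x ≈ y → ρ x ≡ ρ y
  ρ-cong {x} {y} e = let k , ch = chain x in
    ≡.trans (ranked x k ch) (≡.sym (ranked y k (chain-respʳ ch e)))

  ρ-⋖ : ∀ {x y} → x ⋖ y → ρ y ≡ suc (ρ x)
  ρ-⋖ {x} {y} x⋖y = let k , ch = chain x in
    ≡.trans (ranked y (suc k) (chain-snoc ch x⋖y)) (≡.cong suc (≡.sym (ranked x k ch)))

  private
    ρ-<-rec : ∀ n x z → height z ℕ.< n → x < z → ρ x ℕ.< ρ z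
    ρ-<-rec (suc n) x z (s≤s le) x<z =
      let f , x≤f , f⋖z = coatom-above x<z in
      ≡.subst (ρ x ℕ.<_) (≡.sym (ρ-⋖ f⋖z)) (s≤s (case x ≈? f of λ where
        (yes e) → ℕ.≤-reflexive (ρ-cong e)
        (no ne) → ℕ.<⇒≤ (ρ-<-rec n x f (ℕ.<-≤-trans (height-< (proj₁ f⋖z)) le) (x≤f , ne))))

  ρ-< : ∀ {x z} → x < z → ρ x ℕ.< ρ z
  ρ-< x<z = ρ-<-rec _ _ _ (ℕ.n<1+n _) x<z

  ρ-mono : ∀ {x z} → x ≤ z → ρ x ℕ.≤ ρ z
  ρ-mono {x} {z} x≤z with x ≈? z
  ... | yes e = ℕ.≤-reflexive (ρ-cong e)
  ... | no ne = ℕ.<⇒≤ (ρ-< (x≤z , ne))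

  ρ-injective : ∀ {x z} → x ≤ z → ρ z ℕ.≤ ρ x → x ≈ z
  ρ-injective {x} {z} x≤z le with x ≈? z
  ... | yes e = e
  ... | no ne = ⊥-elim (ℕ.<⇒≱ (ρ-< (x≤z , ne)) le)

  ρ-reflects-< : ∀ {x z} → x ≤ z → ρ x ℕ.< ρ z → x < z
  ρ-reflects-< x≤z lt = x≤z , λ e → ℕ.<-irrefl (ρ-cong e) lt

  ρ⇒⋖ : ∀ {x z} → x ≤ z → ρ z ≡ suc (ρ x) → x ⋖ z
  ρ⇒⋖ x≤z eq = ρ-reflects-< x≤z (ℕ.≤-reflexive (≡.sym eq)) , λ y (x<y , y<z) →
    ℕ.<-irrefl ≡.refl (ℕ.<-≤-trans (ρ-< y<z) (≡.subst (ℕ._≤ ρ y) (≡.sym eq) (ρ-< x<y)))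

  ρ𝟎 : ρ 𝟎 ≡ 0
  ρ𝟎 = ranked 𝟎 0 (done Eq.refl)

  ∨-absorbs : ∀ {x y} → y ≤ x → x ∨ y ≈ x
  ∨-absorbs y≤x = antisym (∨-least refl y≤x) (x≤x∨y _ _)

  𝟎<vertex : ∀ {v} → IsVertex v → 𝟎 < v
  𝟎<vertex {v} vv = ρ-reflects-< (𝟎-least v)
    (≡.subst₂ ℕ._<_ (≡.sym ρ𝟎) (≡.sym (vertex⇒ρ vv)) (ℕ.n<1+n 0))

  vertex-≤⇒≈ : ∀ {v w} → IsVertex v → IsVertex w → v ≤ w → v ≈ w
  vertex-≤⇒≈ vv vw v≤w =
    ρ-injective v≤w (ℕ.≤-reflexive (≡.trans (vertex⇒ρ vw) (≡.sym (vertex⇒ρ vv))))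

  no-three-between : ∀ {x z y₁ y₂ y₃} → x < z → ρ z ≡ 2 ℕ.+ ρ x →
    x < y₁ × y₁ < z → x < y₂ × y₂ < z → x < y₃ × y₃ < z →
    ¬ (y₁ ≈ y₂) → ¬ (y₁ ≈ y₃) → ¬ (y₂ ≈ y₃) → ⊥
  no-three-between x<z eq (a , a′) (b , b′) (d , d′) n₁₂ n₁₃ n₂₃
    with diamond _ _ x<z eq
  ... | p , q , _ , _ , _ , only with only _ a a′ | only _ b b′ | only _ d d′
  ... | inj₁ e | inj₁ f | _ = n₁₂ (Eq.trans e (Eq.sym f))
  ... | inj₂ e | inj₂ f | _ = n₁₂ (Eq.trans e (Eq.sym f))
  ... | inj₁ e | inj₂ f | inj₁ g = n₁₃ (Eq.trans e (Eq.sym g))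
  ... | inj₁ e | inj₂ f | inj₂ g = n₂₃ (Eq.trans f (Eq.sym g))
  ... | inj₂ e | inj₁ f | inj₁ g = n₂₃ (Eq.trans f (Eq.sym g))
  ... | inj₂ e | inj₁ f | inj₂ g = n₁₃ (Eq.trans e (Eq.sym g))

  other-between : ∀ {x y z} → x ⋖ y → y ⋖ z →
    ∃ λ y′ → x ⋖ y′ × y′ ⋖ z × ¬ (y ≈ y′)
  other-between {x} {y} {z} x⋖y y⋖z = go (diamond x z x<z ρz)
    where
    x<z : x < z
    x<z = ≤-<-trans (proj₁ (proj₁ x⋖y)) (proj₁ y⋖z)
    ρz : ρ z ≡ 2 ℕ.+ ρ x
    ρz = ≡.trans (ρ-⋖ y⋖z) (≡.cong suc (ρ-⋖ x⋖y))
    covers : ∀ {t} → x < t → t < z → x ⋖ t × t ⋖ z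
    covers {t} x<t t<z = ρ⇒⋖ (proj₁ x<t) ρt , ρ⇒⋖ (proj₁ t<z) (≡.trans ρz (≡.cong suc (≡.sym ρt)))
      where
      ρt : ρ t ≡ suc (ρ x)
      ρt = ℕ.≤-antisym (ℕ.s≤s⁻¹ (≡.subst (ρ t ℕ.<_) ρz (ρ-< t<z))) (ρ-< x<t)
    go : ExactlyTwoBetween x z → ∃ λ y′ → x ⋖ y′ × y′ ⋖ z × ¬ (y ≈ y′)
    go (p , q , (x<p , p<z) , (x<q , q<z) , p≉q , _) with y ≈? p
    ... | no y≉p = let a , b = covers x<p p<z in p , a , b , y≉p
    ... | yes y≈p = let a , b = covers x<q q<z in
      q , a , b , λ y≈q → p≉q (Eq.trans (Eq.sym y≈p) y≈q)

  -- Otherwise `x ∧ y` would lie strictly above `w`, hence be `x`, which covers `w`; then `x ≤ y`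
  -- with equal ranks. So `w` is the meet of `x` and `y`.
  covers-meet : ∀ {w x y a} → w ⋖ x → w ⋖ y → ¬ (x ≈ y) → a ≤ x → a ≤ y → a ≤ w
  covers-meet {w} {x} {y} {a} w⋖x w⋖y x≉y a≤x a≤y with a ≤? w
  ... | yes a≤w = a≤w
  ... | no  a≰w = ⊥-elim (x≉y (ρ-injective x≤y
          (ℕ.≤-reflexive (≡.trans (ρ-⋖ w⋖y) (≡.sym (ρ-⋖ w⋖x))))))
    where
    w<m : w < (x ∧ y)
    w<m = ≤∧≰⇒< (∧-greatest (proj₁ (proj₁ w⋖x)) (proj₁ (proj₁ w⋖y)))
                λ m≤w → a≰w (trans (∧-greatest a≤x a≤y) m≤w)
    x≤y : x ≤ y
    x≤y with (x ∧ y) ≈? x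
    ... | yes e = trans (reflexive (Eq.sym e)) (x∧y≤y x y)
    ... | no ne = ⊥-elim (proj₂ w⋖x (x ∧ y) (w<m , x∧y≤x x y , ne))

  private
    -- Induction on the rank of `y`. For `w` covered by `x`, the diamond property gives a second
    -- element `y′` between `w` and `y`; a vertex of `y′` outside `w` is not below `x`, because `w`
    -- is the meet of `x` and `y′`.
    vertex-diff-rec : ∀ n {x y} → ρ y ℕ.≤ n → x ⋖ y → ∃ λ a → IsVertex a × a ≤ y × ¬ (a ≤ x)
    vertex-diff-rec zero le x⋖y = ⊥-elim (ℕ.n≮0 (ℕ.<-≤-trans (ρ-< (proj₁ x⋖y)) le))
    vertex-diff-rec (suc n) {x} {y} le x⋖y with 𝟎 ≈? x
    ... | yes e = y , ρ⇒vertex (≡.trans (ρ-⋖ x⋖y) (≡.cong suc (≡.trans (≡.sym (ρ-cong e)) ρ𝟎)))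
                , refl , <⇒≱ (proj₁ x⋖y)
    ... | no ne with coatom-above {𝟎} {x} (𝟎-least x , ne)
    ... | w , _ , w⋖x with other-between w⋖x x⋖y
    ... | y′ , w⋖y′ , y′⋖y , x≉y′
      with vertex-diff-rec n (ℕ.s≤s⁻¹ (≡.subst (ℕ._≤ suc n) (ρ-⋖ y′⋖y) le)) w⋖y′
    ... | a , va , a≤y′ , a≰w =
      a , va , trans a≤y′ (proj₁ (proj₁ y′⋖y)) , λ a≤x → a≰w (covers-meet w⋖x w⋖y′ x≉y′ a≤x a≤y′)

  ∃vertex-diff : ∀ {x z} → ¬ (x ≤ z) → ∃ λ a → IsVertex a × a ≤ x × ¬ (a ≤ z)
  ∃vertex-diff {x} {z} x≰z
    with coatom-above {x ∧ z} {x} (≤∧≰⇒< (x∧y≤x x z) λ le → x≰z (trans le (x∧y≤y x z)))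
  ... | g , m≤g , g⋖x with vertex-diff-rec _ ℕ.≤-refl g⋖x
  ... | a , va , a≤x , a≰g = a , va , a≤x , λ a≤z → a≰g (trans (∧-greatest a≤x a≤z) m≤g)

  atomistic : ∀ {x z} → (∀ v → IsVertex v → v ≤ x → v ≤ z) → x ≤ z
  atomistic {x} {z} sub with x ≤? z
  ... | yes x≤z = x≤z
  ... | no  x≰z = let a , va , a≤x , a≰z = ∃vertex-diff x≰z in ⊥-elim (a≰z (sub a va a≤x))

  -- Pyramids: a face with a single vertex added.

  record IsPyramid (x h : Carrier) : Set (c ⊔ ℓ₁ ⊔ ℓ₂) where
    field
      apex∉base : ¬ (x ≤ h)
      vertices  : ∀ v → IsVertex v → v ≤ h ∨ x → v ≤ h ⊎ v ≈ x
      rank      : ρ (h ∨ x) ≡ suc (ρ h)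

  open IsPyramid

  -- The second element `h′` between `g` and `h ∨ x` has a vertex outside `h`, which can only be the
  -- apex; hence `g ∨ x` is `h′`. Its vertices other than `x` lie in `h` and `h′`, whose meet is
  -- `g`.
  pyramid-⋖ : ∀ {x g h} → IsPyramid x h → g ⋖ h → IsPyramid x g
  pyramid-⋖ {x} {g} {h} pyr g⋖h with other-between g⋖h (ρ⇒⋖ (x≤x∨y h x) (rank pyr))
  ... | h′ , g⋖h′ , h′⋖hx , h≉h′ = record
    { apex∉base = λ x≤g → apex∉base pyr (trans x≤g (proj₁ (proj₁ g⋖h)))
    ; vertices  = λ v vv v≤gx → case vertices pyr v vv (trans v≤gx gx≤hx) of λ where
        (inj₁ v≤h) → inj₁ (covers-meet g⋖h g⋖h′ h≉h′ v≤h (trans v≤gx gx≤h′))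
        (inj₂ v≈x) → inj₂ v≈x
    ; rank      = ≡.trans (ρ-cong gx≈h′) (ρ-⋖ g⋖h′)
    }
    where
    h′≰h : ¬ (h′ ≤ h)
    h′≰h h′≤h = h≉h′ (Eq.sym (ρ-injective h′≤h
      (ℕ.≤-reflexive (≡.trans (ρ-⋖ g⋖h) (≡.sym (ρ-⋖ g⋖h′))))))
    x≤h′ : x ≤ h′
    x≤h′ with ∃vertex-diff h′≰h
    ... | a , va , a≤h′ , a≰h with vertices pyr a va (trans a≤h′ (proj₁ (proj₁ h′⋖hx)))
    ... | inj₁ a≤h = ⊥-elim (a≰h a≤h)
    ... | inj₂ a≈x = trans (reflexive (Eq.sym a≈x)) a≤h′
    gx≤h′ : g ∨ x ≤ h′
    gx≤h′ = ∨-least (proj₁ (proj₁ g⋖h′)) x≤h′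
    gx≤hx : g ∨ x ≤ h ∨ x
    gx≤hx = ∨-least (trans (proj₁ (proj₁ g⋖h)) (x≤x∨y h x)) (y≤x∨y h x)
    gx≈h′ : g ∨ x ≈ h′
    gx≈h′ = ρ-injective gx≤h′ (≡.subst (ℕ._≤ ρ (g ∨ x)) (≡.sym (ρ-⋖ g⋖h′))
      (ρ-< (≤∧≰⇒< (x≤x∨y g x) λ gx≤g →
        apex∉base pyr (trans (y≤x∨y g x) (trans gx≤g (proj₁ (proj₁ g⋖h)))))))

  pyramid-resp : ∀ {x g h} → g ≈ h → IsPyramid x h → IsPyramid x g
  pyramid-resp {x} {g} {h} g≈h pyr = record
    { apex∉base = λ x≤g → apex∉base pyr (trans x≤g (reflexive g≈h))
    ; vertices  = λ v vv v≤gx → case vertices pyr v vv (trans v≤gx (reflexive gx≈hx)) of λ where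
        (inj₁ v≤h) → inj₁ (trans v≤h (reflexive (Eq.sym g≈h)))
        (inj₂ v≈x) → inj₂ v≈x
    ; rank      = ≡.trans (ρ-cong gx≈hx) (≡.trans (rank pyr) (≡.cong suc (≡.sym (ρ-cong g≈h))))
    }
    where
    gx≈hx : g ∨ x ≈ h ∨ x
    gx≈hx = antisym (∨-least (trans (reflexive g≈h) (x≤x∨y h x)) (y≤x∨y h x))
                    (∨-least (trans (reflexive (Eq.sym g≈h)) (x≤x∨y g x)) (y≤x∨y g x))

  private
    pyramid-rec : ∀ n {x g h} → ρ h ℕ.≤ n → IsPyramid x h → g ≤ h → IsPyramid x g
    pyramid-rec n {x} {g} {h} le pyr g≤h with g ≈? h
    ... | yes e = pyramid-resp e pyr
    pyramid-rec zero le pyr g≤h | no ne = ⊥-elim (ℕ.n≮0 (ℕ.<-≤-trans (ρ-< (g≤h , ne)) le))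
    pyramid-rec (suc n) le pyr g≤h | no ne =
      let h′ , g≤h′ , h′⋖h = coatom-above (g≤h , ne)
      in pyramid-rec n (ℕ.s≤s⁻¹ (≡.subst (ℕ._≤ suc n) (ρ-⋖ h′⋖h) le)) (pyramid-⋖ pyr h′⋖h) g≤h′

  pyramid-≤ : ∀ {x g h} → IsPyramid x h → g ≤ h → IsPyramid x g
  pyramid-≤ = pyramid-rec _ ℕ.≤-refl

  -- An automorphism that exchanges two vertices and fixes the others.

  module Transposition {x y : Carrier} (vx : IsVertex x) (vy : IsVertex y) (x≉y : ¬ (x ≈ y))
                       {φ : Carrier → Carrier} (aut : IsAutomorphism φ)
                       (act : ActsAsTransposition φ x y) where

    φ-mono : ∀ {a b} → a ≤ b → φ a ≤ φ b
    φ-mono = Equivalence.to (proj₁ aut _ _)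

    φ-reflects : ∀ {a b} → φ a ≤ φ b → a ≤ b
    φ-reflects = Equivalence.from (proj₁ aut _ _)

    φx≈y : φ x ≈ y
    φx≈y = proj₁ act

    φy≈x : φ y ≈ x
    φy≈x = proj₁ (proj₂ act)

    x≤φ⇒y≤ : ∀ {f} → x ≤ φ f → y ≤ f
    x≤φ⇒y≤ x≤φf = φ-reflects (trans (reflexive φy≈x) x≤φf)

    y≤φ⇒x≤ : ∀ {f} → y ≤ φ f → x ≤ f
    y≤φ⇒x≤ y≤φf = φ-reflects (trans (reflexive φx≈y) y≤φf)

    x≤⇒y≤φ : ∀ {f} → x ≤ f → y ≤ φ f
    x≤⇒y≤φ x≤f = trans (reflexive (Eq.sym φx≈y)) (φ-mono x≤f)

    y≤⇒x≤φ : ∀ {f} → y ≤ f → x ≤ φ f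
    y≤⇒x≤φ y≤f = trans (reflexive (Eq.sym φy≈x)) (φ-mono y≤f)

    private
      ≰⇒≉ : ∀ {v f w} → v ≤ f → ¬ (w ≤ f) → ¬ (v ≈ w)
      ≰⇒≉ v≤f w≰f v≈w = w≰f (trans (reflexive (Eq.sym v≈w)) v≤f)

    ≤φ⁺ : ∀ {v f} → IsVertex v → ¬ (v ≈ x) → ¬ (v ≈ y) → v ≤ f → v ≤ φ f
    ≤φ⁺ vv v≉x v≉y v≤f =
      trans (reflexive (Eq.sym (proj₂ (proj₂ act) _ vv v≉x v≉y))) (φ-mono v≤f)

    ≤φ⁻ : ∀ {v f} → IsVertex v → ¬ (v ≈ x) → ¬ (v ≈ y) → v ≤ φ f → v ≤ f
    ≤φ⁻ vv v≉x v≉y v≤φf =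
      φ-reflects (trans (reflexive (proj₂ (proj₂ act) _ vv v≉x v≉y)) v≤φf)

    φ-fixes-outside : ∀ {f} → ¬ (x ≤ f) → ¬ (y ≤ f) → φ f ≈ f
    φ-fixes-outside {f} x≰f y≰f = antisym
      (atomistic λ v vv v≤φf →
        ≤φ⁻ vv (≰⇒≉ v≤φf (y≰f ∘ x≤φ⇒y≤)) (≰⇒≉ v≤φf (x≰f ∘ y≤φ⇒x≤)) v≤φf)
      (atomistic λ v vv v≤f → ≤φ⁺ vv (≰⇒≉ v≤f x≰f) (≰⇒≉ v≤f y≰f) v≤f)

    φ-fixes-inside : ∀ {f} → x ≤ f → y ≤ f → φ f ≈ f
    φ-fixes-inside {f} x≤f y≤f = antisym (atomistic into) (atomistic out)
      where
      into : ∀ v → IsVertex v → v ≤ φ f → v ≤ f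
      into v vv v≤φf with v ≈? x | v ≈? y
      ... | yes e | _ = trans (reflexive e) x≤f
      ... | no _ | yes e = trans (reflexive e) y≤f
      ... | no v≉x | no v≉y = ≤φ⁻ vv v≉x v≉y v≤φf
      out : ∀ v → IsVertex v → v ≤ f → v ≤ φ f
      out v vv v≤f with v ≈? x | v ≈? y
      ... | yes e | _ = trans (reflexive e) (y≤⇒x≤φ y≤f)
      ... | no _ | yes e = trans (reflexive e) (x≤⇒y≤φ x≤f)
      ... | no v≉x | no v≉y = ≤φ⁺ vv v≉x v≉y v≤f

    -- Together with `meet-keeps` this deletes `x` from a face that misses `y`: only `x` is lost in
    -- passing from `f` to `f ∧ φ f`.
    meet-removes : ∀ {f} → ¬ (y ≤ f) → ¬ (x ≤ f ∧ φ f)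
    meet-removes y≰f x≤m = y≰f (x≤φ⇒y≤ (trans x≤m (x∧y≤y _ _)))

    meet-keeps : ∀ {f v} → ¬ (y ≤ f) → IsVertex v → v ≤ f → ¬ (v ≈ x) → v ≤ f ∧ φ f
    meet-keeps y≰f vv v≤f v≉x = ∧-greatest v≤f (≤φ⁺ vv v≉x (≰⇒≉ v≤f y≰f) v≤f)

    private
      CoatomMeets : Carrier → Set (c ⊔ ℓ₁ ⊔ ℓ₂)
      CoatomMeets H = ∀ {f} → x ≤ H → y ≤ H → f ⋖ H → ¬ (x ≤ f) → ¬ (y ≤ f) → ⊥

      -- Starting from a coatom that contains neither vertex, a walk in Λ([𝟎,H]) has to reach a
      -- coatom containing `x`. But no step of it can leave the set of coatoms that contain neither.
      coatom-meets-step : ∀ {H} → (∀ {b} → ρ b ℕ.< ρ H → CoatomMeets b) → CoatomMeets H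
      coatom-meets-step {H} ih {f} x≤H y≤H f⋖H x≰f y≰f = by-rank (ρ f) ≡.refl
        where
        ρH : ρ H ≡ suc (ρ f)
        ρH = ρ-⋖ f⋖H

        φH≈H : φ H ≈ H
        φH≈H = φ-fixes-inside x≤H y≤H

        by-walk : ∀ m → ρ f ≡ suc (suc m) → ⊥
        by-walk m ρf = walk f⋖H x≰f y≰f
            (connected 𝟎 H 𝟎<H 2<ρH f f′ (node f⋖H) (node f′⋖H))
          where
          ρH′ : ρ H ≡ 3 ℕ.+ m
          ρH′ = ≡.trans ρH (≡.cong suc ρf)
          2<ρH : 2 ℕ.+ ρ 𝟎 ℕ.< ρ H
          2<ρH = ≡.subst₂ ℕ._<_ (≡.cong (2 ℕ.+_) (≡.sym ρ𝟎)) (≡.sym ρH′) (s≤s (s≤s (s≤s z≤n)))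
          𝟎<H : 𝟎 < H
          𝟎<H = ≤-<-trans (𝟎-least f) (proj₁ f⋖H)
          x<H : x < H
          x<H = ρ-reflects-< x≤H (≡.subst₂ ℕ._<_ (≡.sym (vertex⇒ρ vx)) (≡.sym ρH′) (s≤s (s≤s z≤n)))
          f′ = proj₁ (coatom-above x<H)
          x≤f′ = proj₁ (proj₂ (coatom-above x<H))
          f′⋖H = proj₂ (proj₂ (coatom-above x<H))
          node : ∀ {b} → b ⋖ H → ΛNode 𝟎 H b
          node b⋖H = 𝟎-least _ , proj₁ (proj₁ b⋖H) , ≡.cong (_∸ 1) (≡.sym (ρ-⋖ b⋖H))
          walk : ∀ {a} → a ⋖ H → ¬ (x ≤ a) → ¬ (y ≤ a) → Walk (ΛNode 𝟎 H) (ΛAdj H) a f′ → ⊥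
          walk a⋖H x≰a y≰a (here a≈f′) = x≰a (trans x≤f′ (reflexive (Eq.sym a≈f′)))
          walk {a} a⋖H x≰a y≰a (step {b = b} (_ , b≤H , ρb) (a≉b , ρg) w) =
            across (x ≤? b) (y ≤? b)
            where
            g = a ∧ b
            ρb′ : ρ b ≡ 2 ℕ.+ m
            ρb′ = ≡.trans ρb (≡.cong (_∸ 1) ρH′)
            ρg′ : ρ g ≡ suc m
            ρg′ = ≡.trans ρg (≡.cong (_∸ 2) ρH′)
            b⋖H : b ⋖ H
            b⋖H = ρ⇒⋖ b≤H (≡.trans ρH′ (≡.cong suc (≡.sym ρb′)))
            g⋖b : g ⋖ b
            g⋖b = ρ⇒⋖ (x∧y≤y a b) (≡.trans ρb′ (≡.cong suc (≡.sym ρg′)))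
            g<a : g < a
            g<a = ρ-reflects-< (x∧y≤x a b)
              (≡.subst₂ ℕ._<_ (≡.sym ρg′) (ℕ.suc-injective (≡.trans (≡.sym ρH′) (ρ-⋖ a⋖H))) (ℕ.n<1+n _))
            x≰g : ¬ (x ≤ g)
            x≰g x≤g = x≰a (trans x≤g (x∧y≤x a b))
            y≰g : ¬ (y ≤ g)
            y≰g y≤g = y≰a (trans y≤g (x∧y≤x a b))
            φb<H : φ b < H
            φb<H = trans (φ-mono b≤H) (reflexive φH≈H) ,
                   λ e → <⇒≱ (proj₁ b⋖H) (φ-reflects (reflexive (Eq.trans φH≈H (Eq.sym e))))
            g≤φb : g ≤ φ b
            g≤φb = trans (reflexive (Eq.sym (φ-fixes-outside x≰g y≰g))) (φ-mono (x∧y≤y a b))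
            -- `φ` fixes `g`, which misses both vertices, so `φ b` also lies between `g` and `H`. If
            -- `b` contains just one of `x` and `y`, then `a`, `b` and `φ b` are distinct, against
            -- the diamond property.
            three : g < φ b → ¬ (a ≈ φ b) → ¬ (b ≈ φ b) → ⊥
            three g<φb a≉φb b≉φb = no-three-between
              (≤-<-trans (proj₁ g<a) (proj₁ a⋖H)) (≡.trans ρH′ (≡.cong (2 ℕ.+_) (≡.sym ρg′)))
              (g<a , proj₁ a⋖H) (proj₁ g⋖b , proj₁ b⋖H) (g<φb , φb<H) a≉b a≉φb b≉φb
            across : Dec (x ≤ b) → Dec (y ≤ b) → ⊥
            across (no x≰b) (no y≰b) = walk b⋖H x≰b y≰b w
            -- Here `g` is a coatom of `b` missing both vertices, which the induction hypothesis
            -- excludes.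
            across (yes x≤b) (yes y≤b) = ih (ρ-< (proj₁ b⋖H)) x≤b y≤b g⋖b x≰g y≰g
            across (yes x≤b) (no y≰b) =
              three (≤∧≰⇒< g≤φb λ φb≤g → y≰g (trans (x≤⇒y≤φ x≤b) φb≤g))
                    (λ e → y≰a (trans (x≤⇒y≤φ x≤b) (reflexive (Eq.sym e))))
                    (λ e → y≰b (trans (x≤⇒y≤φ x≤b) (reflexive (Eq.sym e))))
            across (no x≰b) (yes y≤b) =
              three (≤∧≰⇒< g≤φb λ φb≤g → x≰g (trans (y≤⇒x≤φ y≤b) φb≤g))
                    (λ e → x≰a (trans (y≤⇒x≤φ y≤b) (reflexive (Eq.sym e))))
                    (λ e → x≰b (trans (y≤⇒x≤φ y≤b) (reflexive (Eq.sym e))))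

        -- The axiom `connected` starts at rank three. In rank one both `x` and `y` equal `H`; in
        -- rank two `f`, `x` and `y` are three elements between `𝟎` and `H`.
        by-rank : ∀ k → ρ f ≡ k → ⊥
        by-rank zero ρf = x≉y (Eq.trans (vertex≈H vx x≤H) (Eq.sym (vertex≈H vy y≤H)))
          where
          vertex≈H : ∀ {v} → IsVertex v → v ≤ H → v ≈ H
          vertex≈H vv v≤H = vertex-≤⇒≈ vv (ρ⇒vertex (≡.trans ρH (≡.cong suc ρf))) v≤H
        by-rank (suc zero) ρf = no-three-between
            (≤-<-trans (𝟎-least f) (proj₁ f⋖H)) (≡.trans ρH′ (≡.cong (2 ℕ.+_) (≡.sym ρ𝟎)))
            (𝟎<vertex (ρ⇒vertex ρf) , proj₁ f⋖H)
            (𝟎<vertex vx , vertex<H vx x≤H) (𝟎<vertex vy , vertex<H vy y≤H)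
            (λ e → x≰f (reflexive (Eq.sym e))) (λ e → y≰f (reflexive (Eq.sym e))) x≉y
          where
          ρH′ : ρ H ≡ 2
          ρH′ = ≡.trans ρH (≡.cong suc ρf)
          vertex<H : ∀ {v} → IsVertex v → v ≤ H → v < H
          vertex<H vv v≤H = ρ-reflects-< v≤H
            (≡.subst₂ ℕ._<_ (≡.sym (vertex⇒ρ vv)) (≡.sym ρH′) (ℕ.n<1+n 1))
        by-rank (suc (suc m)) ρf = by-walk m ρf

      coatom-meets-rec : ∀ n {H} → ρ H ℕ.< n → CoatomMeets H
      coatom-meets-rec (suc n) (s≤s le) =
        coatom-meets-step λ lt → coatom-meets-rec n (ℕ.<-≤-trans lt le)

    coatom-meets : ∀ {f H} → x ≤ H → y ≤ H → f ⋖ H → x ≤ f ⊎ y ≤ f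
    coatom-meets {f} x≤H y≤H f⋖H with x ≤? f | y ≤? f
    ... | yes x≤f | _       = inj₁ x≤f
    ... | no  _   | yes y≤f = inj₂ y≤f
    ... | no  x≰f | no  y≰f = ⊥-elim (coatom-meets-rec _ (ℕ.n<1+n _) x≤H y≤H f⋖H x≰f y≰f)

    -- Were `y` in `A ∨ x`, then `φ` would fix both `A` and `A ∨ x`, and a coatom above `A`,
    -- containing `x` or `y`, would contain all of `A ∨ x`. So `y` is absent; deleting `x` leaves a
    -- face `h` above `A` over which `x` is an apex, and this passes down to `A`.
    add-vertex : ∀ {A} → ¬ (x ≤ A) → ¬ (y ≤ A) → IsPyramid x A
    add-vertex {A} x≰A y≰A with y ≤? (A ∨ x)
    ... | yes y≤f = ⊥-elim (absurd (coatom-above A<f))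
      where
      f = A ∨ x
      A<f : A < f
      A<f = ≤∧≰⇒< (x≤x∨y A x) λ f≤A → x≰A (trans (y≤x∨y A x) f≤A)
      absurd : ¬ (∃ λ f′ → A ≤ f′ × f′ ⋖ f)
      absurd (f′ , A≤f′ , f′⋖f) with coatom-meets (y≤x∨y A x) y≤f f′⋖f
      ... | inj₁ x≤f′ = <⇒≱ (proj₁ f′⋖f) (∨-least A≤f′ x≤f′)
      ... | inj₂ y≤f′ = <⇒≱ (proj₁ f′⋖f) (φ-reflects (trans
        (reflexive (φ-fixes-inside (y≤x∨y A x) y≤f))
        (∨-least (trans (reflexive (Eq.sym (φ-fixes-outside x≰A y≰A))) (φ-mono A≤f′))
                 (y≤⇒x≤φ y≤f′))))
    ... | no y≰f = pyramid-≤ (record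
        { apex∉base = meet-removes y≰f
        ; vertices  = λ v vv v≤hx → shadow v vv (trans v≤hx (∨-least (x∧y≤x f (φ f)) (y≤x∨y A x)))
        ; rank      = ρ-⋖ h⋖hx
        }) A≤h
      where
      f = A ∨ x
      h = f ∧ φ f
      A≤h : A ≤ h
      A≤h = ∧-greatest (x≤x∨y A x)
        (trans (reflexive (Eq.sym (φ-fixes-outside x≰A y≰A))) (φ-mono (x≤x∨y A x)))
      shadow : ∀ v → IsVertex v → v ≤ f → v ≤ h ⊎ v ≈ x
      shadow v vv v≤f with v ≈? x
      ... | yes e = inj₂ e
      ... | no ne = inj₁ (meet-keeps y≰f vv v≤f ne)
      hx≤f : h ∨ x ≤ f
      hx≤f = ∨-least (x∧y≤x f (φ f)) (y≤x∨y A x)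
      -- An element strictly in between has a vertex outside `h`, which must be `x`, so it already
      -- contains `h ∨ x`.
      h⋖hx : h ⋖ (h ∨ x)
      h⋖hx = ≤∧≰⇒< (x≤x∨y h x) (λ le → meet-removes y≰f (trans (y≤x∨y h x) le)) ,
        λ t (h<t , t<hx) → case ∃vertex-diff (<⇒≱ h<t) of λ where
          (a , va , a≤t , a≰h) → case shadow a va (trans a≤t (trans (proj₁ t<hx) hx≤f)) of λ where
            (inj₁ a≤h) → a≰h a≤h
            (inj₂ a≈x) → <⇒≱ t<hx (∨-least (proj₁ h<t) (trans (reflexive (Eq.sym a≈x)) a≤t))

-- Canonical choice from a finite list.

module FirstSatisfying {A : Set} where

  first : ∀ {P : A → Set} → (∀ x → Dec (P x)) → A → List A → A
  first P? d [] = d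
  first P? d (x ∷ xs) with P? x
  ... | yes _ = x
  ... | no  _ = first P? d xs

  first-satisfies : ∀ {P : A → Set} (P? : ∀ x → Dec (P x)) {d xs} → Any P xs → P (first P? d xs)
  first-satisfies P? {xs = x ∷ xs} p with P? x | p
  ... | yes px | _        = px
  ... | no ¬px | here px  = ⊥-elim (¬px px)
  ... | no _   | there p′ = first-satisfies P? p′

  -- Once some entry satisfies the predicate, the result depends only on its extension, not on the
  -- decision procedure or the default. This gives equivalent vertices propositionally equal
  -- representatives.
  first-cong : ∀ {P Q : A → Set} (P? : ∀ x → Dec (P x)) (Q? : ∀ x → Dec (Q x)) {d e xs} →
               (∀ {x} → P x → Q x) → (∀ {x} → Q x → P x) → Any P xs →
               first P? d xs ≡ first Q? e xs
  first-cong P? Q? {xs = x ∷ xs} to from p with P? x | Q? x | p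
  ... | yes _  | yes _  | _        = ≡.refl
  ... | yes px | no ¬qx | _        = ⊥-elim (¬qx (to px))
  ... | no ¬px | yes qx | _        = ⊥-elim (¬px (from qx))
  ... | no ¬px | no _   | here px  = ⊥-elim (¬px px)
  ... | no _   | no _   | there p′ = first-cong P? Q? to from p′

-- Proper pseudomanifolds: classical reasoning and decidable membership of vertices.

module ProperCPM (M : Poset 0ℓ 0ℓ 0ℓ) (cM : IsCPM M) (proper : IsCPM.Proper cM) where
  open Poset M using (Carrier; _≈_; _≤_; refl; reflexive; trans; antisym; module Eq)
  open PosetNotions M
  open IsCPM cM
  open IsLattice isLattice using (x≤x∨y; y≤x∨y; ∨-least; x∧y≤x; x∧y≤y; ∧-greatest)
  open CPMBasics M cM
  open FirstSatisfying

  module Classical (dec : ∀ x y → Dec (x ≤ y)) = DecidableCPM M cM dec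

  -- The gateway from `¬¬-decidable` to the results for decidable orders. Its goal must be
  -- decidable, which is why much of what follows is phrased through `_∈ᶠ_`.
  classically : ∀ {a} {A : Set a} → Dec A → ((∀ x y → Dec (x ≤ y)) → A) → A
  classically A? k = decidable-stable A? λ ¬a → ¬¬-decidable (¬a ∘ k)

  Vertex : Set
  Vertex = Σ Carrier IsVertex

  _∈ᶠ_ : Vertex → Carrier → Set
  v ∈ᶠ f = proj₁ v ≤ f

  _≈ᵛ_ _∼ᵛ_ : Vertex → Vertex → Set
  v ≈ᵛ w = proj₁ v ≈ proj₁ w
  v ∼ᵛ w = proj₁ v ∼ proj₁ w

  cl : Vertex → Carrier
  cl (v , vv) = proj₁ (proper v vv)

  ∼⇒∈cl : ∀ {v w} → v ∼ᵛ w → w ∈ᶠ cl v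
  ∼⇒∈cl {v , vv} {w , vw} v∼w = proj₂ (Equivalence.to (proj₂ (proper v vv) w) (vw , v∼w))

  ∈cl⇒∼ : ∀ {v w} → w ∈ᶠ cl v → v ∼ᵛ w
  ∈cl⇒∼ {v , vv} {w , vw} w∈ = proj₂ (Equivalence.from (proj₂ (proper v vv) w) (vw , w∈))

  -- Properness makes the vertices genuine atoms even though equality in M need not be stable.
  subvertex : ∀ {v w} → w ∈ᶠ proj₁ v → v ∈ᶠ proj₁ w
  subvertex {v} {w} w≤v with ∈cl⇒∼ {v} {w} (trans w≤v (∼⇒∈cl {v} {v} (inj₁ Eq.refl)))
  ... | inj₁ v≈w = reflexive v≈w
  ... | inj₂ (φ , (order , _) , φv≈w , φw≈v , _) =
    trans (reflexive (Eq.sym φw≈v)) (trans (Equivalence.to (order _ _) w≤v) (reflexive φv≈w))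

  ∈-vertex : ∀ {v w} → v ∈ᶠ proj₁ w → v ≈ᵛ w
  ∈-vertex {v} {w} v≤w = antisym v≤w (subvertex {w} {v} v≤w)

  -- The rank of `x ∧ f` decides: if it is one, the meet is a vertex below `x`, hence also above `x`
  -- by `subvertex`; if `x ≤ f`, the meet equals `x` and has rank one.
  _∈ᶠ?_ : ∀ v f → Dec (v ∈ᶠ f)
  v@(x , vx) ∈ᶠ? f with ρ (x ∧ f) ℕ.≟ 1
  ... | yes e = yes (trans (subvertex {v} {_ , ρ⇒vertex e} (x∧y≤x x f)) (x∧y≤y x f))
  ... | no ne = no λ x≤f → ¬¬-decidable λ dec → ne (≡.trans
          (Classical.ρ-cong dec (antisym (x∧y≤x x f) (∧-greatest refl x≤f))) (vertex⇒ρ vx))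

  _∼?_ : ∀ v w → Dec (v ∼ᵛ w)
  v ∼? w = map′ (∈cl⇒∼ {v} {w}) (∼⇒∈cl {v} {w}) (w ∈ᶠ? cl v)

  _≈ᵛ?_ : ∀ v w → Dec (v ≈ᵛ w)
  v ≈ᵛ? w = map′ (∈-vertex {v} {w}) reflexive (v ∈ᶠ? proj₁ w)

  -- For distinct `x`, `y`, `z` the conjugate `φ ∘ ψ ∘ φ` exchanges `x` and `z` and fixes the other
  -- vertices.
  ∼-trans : ∀ {x y z} → x ∼ᵛ y → y ∼ᵛ z → x ∼ᵛ z
  ∼-trans (inj₁ x≈y) y∼z = ∼-respˡ (Eq.sym x≈y) y∼z
  ∼-trans p@(inj₂ _) (inj₁ y≈z) = ∼-sym (∼-respˡ y≈z (∼-sym p))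
  ∼-trans {x} {y} {z} p@(inj₂ (φ , autφ , φx≈y , φy≈x , fixφ)) q@(inj₂ (ψ , autψ , ψy≈z , ψz≈y , fixψ))
    with x ≈ᵛ? z | x ≈ᵛ? y | y ≈ᵛ? z
  ... | yes x≈z | _ | _ = inj₁ x≈z
  ... | no _ | yes x≈y | _ = ∼-respˡ (Eq.sym x≈y) q
  ... | no _ | no _ | yes y≈z = ∼-sym (∼-respˡ y≈z (∼-sym p))
  ... | no x≉z | no x≉y | no y≉z =
    inj₂ (φ ∘ ψ ∘ φ , automorphism-∘ autφ (automorphism-∘ autψ autφ) ,
          via φx≈y ψy≈z (fixφ _ (proj₂ z) (x≉z ∘ Eq.sym) (y≉z ∘ Eq.sym)) ,
          via (fixφ _ (proj₂ z) (x≉z ∘ Eq.sym) (y≉z ∘ Eq.sym)) ψz≈y φy≈x ,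
          λ v vv v≉x v≉z → fixes (v , vv) v≉x v≉z)
    where
    via : ∀ {a b d e} → φ a ≈ b → ψ b ≈ d → φ d ≈ e → φ (ψ (φ a)) ≈ e
    via p₁ p₂ p₃ = Eq.trans (automorphism-cong autφ
      (Eq.trans (automorphism-cong autψ p₁) p₂)) p₃
    fixes : ∀ v → ¬ (v ≈ᵛ x) → ¬ (v ≈ᵛ z) → φ (ψ (φ (proj₁ v))) ≈ proj₁ v
    fixes v v≉x v≉z with v ≈ᵛ? y
    ... | yes v≈y = Eq.trans
            (via (Eq.trans (automorphism-cong autφ v≈y) φy≈x) (fixψ _ (proj₂ x) x≉y x≉z) φx≈y)
            (Eq.sym v≈y)
    ... | no v≉y = via φv≈v (fixψ _ (proj₂ v) v≉y v≉z) φv≈v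
      where φv≈v = fixφ _ (proj₂ v) v≉x v≉y

  private
    vertices : List Carrier → List Vertex
    vertices [] = []
    vertices (x ∷ xs) with vertex? x
    ... | yes vx = (x , vx) ∷ vertices xs
    ... | no _   = vertices xs

    vertices⁺ : ∀ {v xs} → Any (proj₁ v ≈_) xs → Any (v ≈ᵛ_) (vertices xs)
    vertices⁺ {v} {x ∷ xs} p with vertex? x | p
    ... | yes _ | here e = here e
    ... | yes _ | there p′ = there (vertices⁺ {v} p′)
    ... | no _ | there p′ = vertices⁺ {v} p′
    ... | no ¬vx | here e = ⊥-elim (¬¬-decidable λ dec → ¬vx (ρ⇒vertex
            (≡.trans (≡.sym (Classical.ρ-cong dec e)) (vertex⇒ρ (proj₂ v)))))

  vs : List Vertex
  vs = vertices (proj₁ finite)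

  covers : ∀ v → ∃ λ w → w ∈ vs × v ≈ᵛ w
  covers v = find (vertices⁺ {v} (proj₂ finite (proj₁ v)))

  Respects≈ : (Vertex → Set) → Set
  Respects≈ S = ∀ v w → v ≈ᵛ w → S v → S w

  ∀vertex? : ∀ {S} → Respects≈ S → (∀ v → Dec (S v)) → Dec (∀ v → S v)
  ∀vertex? resp S? = map′
    (λ all v → let w , w∈ , v≈w = covers v in resp w v (Eq.sym v≈w) (All.lookup all w∈))
    (λ f → All.tabulate λ {v} _ → f v)
    (All.all? S? vs)

  ¬∀⇒∃¬ : ∀ {S : Vertex → Set} → Respects≈ S → (∀ v → Dec (S v)) → ¬ (∀ v → S v) → ∃ λ v → ¬ S v
  ¬∀⇒∃¬ resp S? ¬all with Any.any? (¬? ∘ S?) vs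
  ... | yes p = Any.satisfied p
  ... | no ¬p = ⊥-elim (¬all λ v → let w , w∈ , v≈w = covers v in
          decidable-stable (S? v) λ ¬Sv → ¬p (lose w∈ (¬Sv ∘ resp w v (Eq.sym v≈w))))

  -- Comparison of faces by their shadows.

  infix 4 _⊑_ _≃_

  -- A decidable substitute for `_≤_`. The two agree as soon as the order is decided, by
  -- `atomistic`.
  _⊑_ _≃_ : Carrier → Carrier → Set
  f ⊑ g = ∀ v → v ∈ᶠ f → v ∈ᶠ g
  f ≃ g = f ⊑ g × g ⊑ f

  ≤⇒⊑ : ∀ {f g} → f ≤ g → f ⊑ g
  ≤⇒⊑ f≤g v v∈f = trans v∈f f≤g

  ≈⇒≃ : ∀ {f g} → f ≈ g → f ≃ g
  ≈⇒≃ e = ≤⇒⊑ (reflexive e) , ≤⇒⊑ (reflexive (Eq.sym e))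

  ⊑-trans : ∀ {f g h} → f ⊑ g → g ⊑ h → f ⊑ h
  ⊑-trans p q v = q v ∘ p v

  ⊑⇒≤ : (∀ x y → Dec (x ≤ y)) → ∀ {f g} → f ⊑ g → f ≤ g
  ⊑⇒≤ dec f⊑g = Classical.atomistic dec λ v vv → f⊑g (v , vv)

  ≃⇒≈ : (∀ x y → Dec (x ≤ y)) → ∀ {f g} → f ≃ g → f ≈ g
  ≃⇒≈ dec (p , q) = antisym (⊑⇒≤ dec p) (⊑⇒≤ dec q)

  ≉⇒≄ : ∀ {f g} → ¬ (f ≈ g) → ¬ (f ≃ g)
  ≉⇒≄ f≉g f≃g = ¬¬-decidable λ dec → f≉g (≃⇒≈ dec f≃g)

  _⊑?_ : ∀ f g → Dec (f ⊑ g)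
  f ⊑? g = ∀vertex? (λ _ _ v≈w k w∈f → trans (reflexive (Eq.sym v≈w)) (k (trans (reflexive v≈w) w∈f)))
                    (λ v → (v ∈ᶠ? f) →-dec (v ∈ᶠ? g))

  ∨-⊑ : ∀ {f g h} → f ⊑ h → g ⊑ h → (f ∨ g) ⊑ h
  ∨-⊑ f⊑h g⊑h v v∈ = classically (v ∈ᶠ? _) λ dec →
    trans v∈ (∨-least (⊑⇒≤ dec f⊑h) (⊑⇒≤ dec g⊑h))

  ⋁-⊑ : ∀ {h} fs → (∀ {f} → f ∈ fs → f ⊑ h) → ⋁ fs ⊑ h
  ⋁-⊑ fs ub v v∈ = classically (v ∈ᶠ? _) λ dec →
    trans v∈ (⋁-least fs (⊑⇒≤ dec ∘ ub))

  ρ-cong-≃ : ∀ {f g} → f ≃ g → ρ f ≡ ρ g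
  ρ-cong-≃ f≃g = classically (_ ℕ.≟ _) λ dec → Classical.ρ-cong dec (≃⇒≈ dec f≃g)

  ∉𝟎 : ∀ v → ¬ (v ∈ᶠ 𝟎)
  ∉𝟎 (v , vv) v≤𝟎 = ¬¬-decidable λ dec →
    Classical.<⇒≱ dec (Classical.𝟎<vertex dec vv) v≤𝟎

  -- Saturated faces and the classes inside a face.

  Saturated : Carrier → Set
  Saturated f = ∀ v w → v ∼ᵛ w → v ∈ᶠ f → w ∈ᶠ f

  saturated-𝟎 : Saturated 𝟎
  saturated-𝟎 v _ _ v∈𝟎 = ⊥-elim (∉𝟎 v v∈𝟎)

  saturated-𝟏 : Saturated 𝟏
  saturated-𝟏 _ _ _ _ = 𝟏-greatest _

  saturated-cl : ∀ v → Saturated (cl v)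
  saturated-cl v w u w∼u w∈ = ∼⇒∈cl {v} {u} (∼-trans {v} {w} {u} (∈cl⇒∼ {v} {w} w∈) w∼u)

  saturated-∧ : ∀ {f g} → Saturated f → Saturated g → Saturated (f ∧ g)
  saturated-∧ sf sg v w v∼w v∈ = ∧-greatest
    (sf v w v∼w (trans v∈ (x∧y≤x _ _))) (sg v w v∼w (trans v∈ (x∧y≤y _ _)))

  -- An automorphism exchanging `v` and `w` fixes `f` and `g`, as each contains both vertices or
  -- neither. So the preimage `t` of `f ∨ g` lies above `f ∨ g` and contains `v`; applying the
  -- automorphism puts `w` in `f ∨ g`.
  saturated-∨ : ∀ {f g} → Saturated f → Saturated g → Saturated (f ∨ g)
  saturated-∨ sf sg v w (inj₁ v≈w) v∈ = trans (reflexive (Eq.sym v≈w)) v∈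
  saturated-∨ {f} {g} sf sg v@(_ , vv) w@(_ , vw) v∼w@(inj₂ (φ , aut , act)) v∈ with v ≈ᵛ? w
  ... | yes v≈w = trans (reflexive (Eq.sym v≈w)) v∈
  ... | no  v≉w = classically (w ∈ᶠ? (f ∨ g)) λ dec →
    let open Classical.Transposition dec vv vw v≉w aut act
        t , φt≈ = proj₂ aut (f ∨ g)
        invariant : ∀ {h} → Saturated h → φ h ≈ h
        invariant {h} sh = case v ∈ᶠ? h of λ where
          (yes v∈h) → φ-fixes-inside v∈h (sh v w v∼w v∈h)
          (no  v∉h) → φ-fixes-outside v∉h (v∉h ∘ sh w v (∼-sym v∼w))
        below : ∀ {h} → Saturated h → h ≤ f ∨ g → h ≤ t
        below sh h≤ = φ-reflects (trans (reflexive (invariant sh)) (trans h≤ (reflexive (Eq.sym φt≈))))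
    in trans (x≤⇒y≤φ (trans v∈ (∨-least (below sf (x≤x∨y f g)) (below sg (y≤x∨y f g)))))
             (reflexive φt≈)

  saturated-⋁ : ∀ fs → (∀ {f} → f ∈ fs → Saturated f) → Saturated (⋁ fs)
  saturated-⋁ []       _ = saturated-𝟎
  saturated-⋁ (f ∷ fs) s = saturated-∨ (s (here ≡.refl)) (saturated-⋁ fs (s ∘ there))

  cl⊑ : ∀ {v f} → Saturated f → v ∈ᶠ f → cl v ⊑ f
  cl⊑ {v} sf v∈f w w∈ = sf v w (∈cl⇒∼ {v} {w} w∈) v∈f

  classesIn : Carrier → List Carrier
  classesIn g = map cl (filter (λ v → cl v ⊑? g) vs)

  -- The union of the classes contained in `g`, and the largest saturated face inside `g`: the join
  -- picks up no further vertices because it is saturated and stays inside `g`.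
  kernel : Carrier → Carrier
  kernel g = ⋁ (classesIn g)

  saturated-kernel : ∀ g → Saturated (kernel g)
  saturated-kernel g = saturated-⋁ (classesIn g) λ f∈ →
    case ∈-map⁻ cl f∈ of λ { (v , _ , ≡.refl) → saturated-cl v }

  kernel⊑ : ∀ g → kernel g ⊑ g
  kernel⊑ g = ⋁-⊑ (classesIn g) λ f∈ → case ∈-map⁻ cl f∈ of λ where
    (v , v∈ , ≡.refl) → proj₂ (∈-filter⁻ (λ v → cl v ⊑? g) {xs = vs} v∈)

  ∈kernel : ∀ {g} v → cl v ⊑ g → v ∈ᶠ kernel g
  ∈kernel {g} v clv⊑g =
    let w , w∈vs , v≈w = covers v
        w∼v = inj₁ (Eq.sym v≈w)
        clw⊑g = λ u u∈ → clv⊑g u (∼⇒∈cl {v} {u} (∼-respˡ (Eq.sym v≈w) (∈cl⇒∼ {w} {u} u∈)))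
    in trans (∼⇒∈cl {w} {v} w∼v) (⋁-upper (∈-map⁺ cl (∈-filter⁺ (λ v → cl v ⊑? g) w∈vs clw⊑g)))

  ⊑kernel : ∀ {f g} → Saturated f → f ⊑ g → f ⊑ kernel g
  ⊑kernel sf f⊑g v v∈f = ∈kernel v (⊑-trans (cl⊑ {v} sf v∈f) f⊑g)

  -- Class representatives and the face of all other vertices.

  rep : Vertex → Vertex
  -- The default `v` is never reached, since `vs` lists a vertex equal to `v`.
  rep v = first (v ∼?_) v vs

  private
    related : ∀ v → Any (v ∼ᵛ_) vs
    related v = let w , w∈ , v≈w = covers v in lose w∈ (inj₁ v≈w)

  ∼rep : ∀ v → v ∼ᵛ rep v
  ∼rep v = first-satisfies (v ∼?_) (related v)

  rep-cong : ∀ {v w} → v ∼ᵛ w → rep v ≡ rep w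
  rep-cong {v} {w} v∼w = first-cong (v ∼?_) (w ∼?_)
    (λ {u} → ∼-trans {w} {v} {u} (∼-sym v∼w)) (λ {u} → ∼-trans {v} {w} {u} v∼w) (related v)

  NonRep : Vertex → Set
  NonRep v = ¬ (v ≈ᵛ rep v)

  nonRep? : ∀ v → Dec (NonRep v)
  nonRep? v = ¬? (v ≈ᵛ? rep v)

  nonRep-resp : Respects≈ NonRep
  nonRep-resp v w v≈w nr w≈rep =
    nr (≡.subst (λ r → proj₁ v ≈ proj₁ r) (≡.sym (rep-cong {v} {w} (inj₁ v≈w))) (Eq.trans v≈w w≈rep))

  rep-isRep : ∀ v → ¬ NonRep (rep v)
  rep-isRep v nr = nr (Eq.reflexive (≡.cong proj₁ (rep-cong {v} {rep v} (∼rep v))))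

  -- Each class contributes all its vertices except its representative. That the join acquires no
  -- representative is shown only in `∈N⇒nonRep`.
  N : Carrier
  N = ⋁ (map proj₁ (filter nonRep? vs))

  nonRep⇒∈N : ∀ v → NonRep v → v ∈ᶠ N
  nonRep⇒∈N v nr = let w , w∈vs , v≈w = covers v in trans (reflexive v≈w)
    (⋁-upper (∈-map⁺ proj₁ (∈-filter⁺ nonRep? w∈vs (nonRep-resp v w v≈w nr))))

  -- Adding vertices one at a time inside a given vertex set.

  module AddVertices (dec : ∀ x y → Dec (x ≤ y)) (S : Vertex → Set) (resp : Respects≈ S) where
    open Classical dec using (IsPyramid; module IsPyramid; module Transposition; ∨-absorbs)

    -- A partner outside `S` stays outside every face reached within `S`, so `add-vertex` applies at
    -- every stage with `v` and its partner as the exchanged pair.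
    HasPartnerOutside : Vertex → Set
    HasPartnerOutside v = ∃ λ r → v ∼ᵛ r × ¬ S r

    pyramid : ∀ {A v} → (∀ u → u ∈ᶠ A → S u) → S v → HasPartnerOutside v → ¬ (v ∈ᶠ A) →
              IsPyramid (proj₁ v) A
    pyramid {A} {v} A⊆S Sv (r , inj₁ v≈r , ¬Sr) v∉A = ⊥-elim (¬Sr (resp v r v≈r Sv))
    pyramid {A} {v} A⊆S Sv (r , inj₂ (φ , aut , act) , ¬Sr) v∉A =
      Transposition.add-vertex (proj₂ v) (proj₂ r) (λ v≈r → ¬Sr (resp v r v≈r Sv)) aut act
        v∉A (¬Sr ∘ A⊆S r)

    -- Induction on `L`: an entry already in `A` leaves it unchanged, and by `pyramid` any other
    -- entry adds only itself, so the enlarged face remains inside `S`.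
    shadow-∨⋁ : ∀ A (L : List Vertex) → (∀ u → u ∈ᶠ A → S u) →
      (∀ {v} → v ∈ L → S v × (v ∈ᶠ A ⊎ HasPartnerOutside v)) →
      ∀ u → u ∈ᶠ (A ∨ ⋁ (map proj₁ L)) → u ∈ᶠ A ⊎ ∃ λ w → w ∈ L × u ≈ᵛ w
    shadow-∨⋁ A [] A⊆S _ u u∈ = inj₁ (trans u∈ (∨-least refl (𝟎-least A)))
    shadow-∨⋁ A (v ∷ L) A⊆S hyp u u∈ =
      case shadow-∨⋁ A′ L A′⊆S hyp′ u (trans u∈ (reflexive (∨-assoc _ _ _))) of λ where
        (inj₂ (w , w∈L , u≈w)) → inj₂ (w , there w∈L , u≈w)
        (inj₁ u∈A′) → case split u u∈A′ of λ where
          (inj₁ u∈A) → inj₁ u∈A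
          (inj₂ u≈v) → inj₂ (v , here ≡.refl , u≈v)
      where
      A′ = A ∨ proj₁ v
      split : ∀ u → u ∈ᶠ A′ → u ∈ᶠ A ⊎ u ≈ᵛ v
      split u u∈A′ with v ∈ᶠ? A | hyp (here ≡.refl)
      ... | yes v∈A | _ = inj₁ (trans u∈A′ (∨-least refl v∈A))
      ... | no v∉A | _ , inj₁ v∈A = ⊥-elim (v∉A v∈A)
      ... | no v∉A | Sv , inj₂ partner =
        IsPyramid.vertices (pyramid {A} {v} A⊆S Sv partner v∉A) (proj₁ u) (proj₂ u) u∈A′
      A′⊆S : ∀ u → u ∈ᶠ A′ → S u
      A′⊆S u u∈A′ with split u u∈A′
      ... | inj₁ u∈A = A⊆S u u∈A
      ... | inj₂ u≈v = resp v u (Eq.sym u≈v) (proj₁ (hyp (here ≡.refl)))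
      hyp′ : ∀ {w} → w ∈ L → S w × (w ∈ᶠ A′ ⊎ HasPartnerOutside w)
      hyp′ w∈L with hyp (there w∈L)
      ... | Sw , inj₁ w∈A = Sw , inj₁ (trans w∈A (x≤x∨y A (proj₁ v)))
      ... | Sw , inj₂ p = Sw , inj₂ p

    -- Entries that are distinct and outside `A` are still missing when their turn comes, and each
    -- pyramid raises the rank by one.
    rank-∨⋁ : ∀ A (L : List Vertex) → (∀ u → u ∈ᶠ A → S u) → AllPairs (λ v w → ¬ (v ≈ᵛ w)) L →
      (∀ {v} → v ∈ L → S v × HasPartnerOutside v × ¬ (v ∈ᶠ A)) →
      ρ (A ∨ ⋁ (map proj₁ L)) ≡ length L ℕ.+ ρ A
    rank-∨⋁ A [] A⊆S _ _ = Classical.ρ-cong dec (∨-absorbs (𝟎-least A))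
    rank-∨⋁ A (v ∷ L) A⊆S (v≉L ∷ distinct) hyp =
      ≡.trans (Classical.ρ-cong dec (∨-assoc _ _ _))
        (≡.trans (rank-∨⋁ A′ L A′⊆S distinct hyp′)
          (≡.trans (≡.cong (length L ℕ.+_) (IsPyramid.rank pyr)) (ℕ.+-suc (length L) (ρ A))))
      where
      A′ = A ∨ proj₁ v
      pyr : IsPyramid (proj₁ v) A
      pyr = let Sv , partner , v∉A = hyp (here ≡.refl) in pyramid {A} {v} A⊆S Sv partner v∉A
      split : ∀ u → u ∈ᶠ A′ → u ∈ᶠ A ⊎ u ≈ᵛ v
      split u = IsPyramid.vertices pyr (proj₁ u) (proj₂ u)
      A′⊆S : ∀ u → u ∈ᶠ A′ → S u
      A′⊆S u u∈A′ with split u u∈A′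
      ... | inj₁ u∈A = A⊆S u u∈A
      ... | inj₂ u≈v = resp v u (Eq.sym u≈v) (proj₁ (hyp (here ≡.refl)))
      hyp′ : ∀ {w} → w ∈ L → S w × HasPartnerOutside w × ¬ (w ∈ᶠ A′)
      hyp′ {w} w∈L = let Sw , partner , w∉A = hyp (there w∈L) in Sw , partner , λ w∈A′ →
        case split w w∈A′ of λ where
          (inj₁ w∈A) → w∉A w∈A
          (inj₂ w≈v) → All.lookup v≉L w∈L (Eq.sym w≈v)

  -- Take `S` to be `A` together with the non-representatives. The partner of a non-representative
  -- outside `A` is its representative, which is not in `A` because `A` is saturated.
  shadow-∨N : ∀ {A} → Saturated A → ∀ u → u ∈ᶠ (A ∨ N) → u ∈ᶠ A ⊎ NonRep u
  shadow-∨N {A} sA u u∈ = classically ((u ∈ᶠ? A) ⊎-dec nonRep? u) λ dec →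
    case AddVertices.shadow-∨⋁ dec S resp A (filter nonRep? vs) (λ _ → inj₁) hyp u u∈ of λ where
      (inj₁ u∈A) → inj₁ u∈A
      (inj₂ (w , w∈ , u≈w)) → inj₂
        (nonRep-resp w u (Eq.sym u≈w) (proj₂ (∈-filter⁻ nonRep? {xs = vs} w∈)))
    where
    S : Vertex → Set
    S v = v ∈ᶠ A ⊎ NonRep v
    resp : Respects≈ S
    resp _ _ v≈w (inj₁ v∈A) = inj₁ (trans (reflexive (Eq.sym v≈w)) v∈A)
    resp v w v≈w (inj₂ nr) = inj₂ (nonRep-resp v w v≈w nr)
    hyp : ∀ {v} → v ∈ filter nonRep? vs → S v × (v ∈ᶠ A ⊎ ∃ λ r → v ∼ᵛ r × ¬ S r)
    hyp {v} v∈ with v ∈ᶠ? A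
    ... | yes v∈A = inj₁ v∈A , inj₁ v∈A
    ... | no v∉A = inj₂ (proj₂ (∈-filter⁻ nonRep? {xs = vs} v∈)) , inj₂ (rep v , ∼rep v , λ where
      (inj₁ r∈A) → v∉A (sA (rep v) v (∼-sym (∼rep v)) r∈A)
      (inj₂ nr) → rep-isRep v nr)

  ∈N⇒nonRep : ∀ v → v ∈ᶠ N → NonRep v
  ∈N⇒nonRep v v∈N with shadow-∨N saturated-𝟎 v (trans v∈N (y≤x∨y 𝟎 N))
  ... | inj₁ v∈𝟎 = ⊥-elim (∉𝟎 v v∈𝟎)
  ... | inj₂ nr = nr

  -- Inclusion can be tested on representatives, which `N` does not contain; saturation extends it
  -- to whole classes.
  ⊑∨N⇒⊑ : ∀ {A B} → Saturated A → Saturated B → A ⊑ (B ∨ N) → A ⊑ B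
  ⊑∨N⇒⊑ sA sB A⊑ v v∈A with shadow-∨N sB (rep v) (A⊑ (rep v) (sA v (rep v) (∼rep v) v∈A))
  ... | inj₁ r∈B = sB (rep v) v (∼-sym (∼rep v)) r∈B
  ... | inj₂ nr = ⊥-elim (rep-isRep v nr)

  -- If `g` contains `N` and a representative, it contains the whole class, since the rest of the
  -- class lies in `N`. All other vertices of `g` are in `N` anyway.
  kernel∨N : ∀ {g} → N ⊑ g → (kernel g ∨ N) ≃ g
  kernel∨N {g} N⊑g = ∨-⊑ (kernel⊑ g) N⊑g , λ v v∈g → case nonRep? v of λ where
      (yes nr) → trans (nonRep⇒∈N v nr) (y≤x∨y _ _)
      (no ¬nr) → trans (∈kernel v (class v v∈g (decidable-stable (v ≈ᵛ? rep v) ¬nr))) (x≤x∨y _ _)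
    where
    class : ∀ v → v ∈ᶠ g → v ≈ᵛ rep v → cl v ⊑ g
    class v v∈g v≈r w w∈ with nonRep? w
    ... | yes nr = N⊑g w (nonRep⇒∈N w nr)
    ... | no ¬nr = trans (reflexive (Eq.trans (decidable-stable (w ≈ᵛ? rep w) ¬nr)
            (Eq.trans (Eq.reflexive (≡.cong proj₁ (≡.sym (rep-cong {v} {w} (∈cl⇒∼ {v} {w} w∈)))))
                      (Eq.sym v≈r)))) v∈g

-- The lattice `M/∼` and its isomorphism with the interval above `N`.

module QuotientCPM (M : Poset 0ℓ 0ℓ 0ℓ) (cM : IsCPM M) (proper : IsCPM.Proper cM) where
  open Poset M using (Carrier; _≤_; refl; reflexive; trans; antisym; module Eq)
  open PosetNotions M using (_<_; _⋖_; Walk; here; step)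
  open IsCPM cM
  open IsLattice isLattice using (x≤x∨y; y≤x∨y; ∨-least; x∧y≤x; x∧y≤y; ∧-greatest)
  open CPMBasics M cM
  open ProperCPM M cM proper
  open Quotient M cM
  open QElem
  module QN = PosetNotions M/∼

  face : QElem → Carrier
  face A = proj₁ (isShadow A)

  ∈face : ∀ {A v} → D A v → IsVertex v × v ≤ face A
  ∈face {A} {v} = Equivalence.to (proj₂ (isShadow A) v)

  face∈ : ∀ {A} v → v ∈ᶠ face A → D A (proj₁ v)
  face∈ {A} (v , vv) v≤ = Equivalence.from (proj₂ (isShadow A) v) (vv , v≤)

  saturated-face : ∀ A → Saturated (face A)
  saturated-face A v w v∼w v∈ =
    proj₂ (∈face {A} (saturated A (proj₁ v) (proj₁ w) (face∈ {A} v v∈) (proj₂ w) v∼w))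

  ≤Q⇒⊑ : ∀ {A B} → A ≤Q B → face A ⊑ face B
  ≤Q⇒⊑ {A} {B} A≤B v v∈ = proj₂ (∈face {B} (A≤B (proj₁ v) (face∈ {A} v v∈)))

  ⊑⇒≤Q : ∀ {A B} → face A ⊑ face B → A ≤Q B
  ⊑⇒≤Q {A} {B} A⊑B v v∈A = let vv , v≤ = ∈face {A} v∈A in face∈ {B} (v , vv) (A⊑B (v , vv) v≤)

  ≤Q-antisym : ∀ {A B} → A ≤Q B → B ≤Q A → A ≈Q B
  ≤Q-antisym A≤B B≤A v = mk⇔ (A≤B v) (B≤A v)

  ≈Q⇒≤Q : ∀ {A B} → A ≈Q B → A ≤Q B
  ≈Q⇒≤Q e v = Equivalence.to (e v)

  ≈Q⇒≥Q : ∀ {A B} → A ≈Q B → B ≤Q A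
  ≈Q⇒≥Q e v = Equivalence.from (e v)

  ≤Q? : ∀ A B → Dec (A ≤Q B)
  ≤Q? A B = map′ (⊑⇒≤Q {A} {B}) (≤Q⇒⊑ {A} {B}) (face A ⊑? face B)

  ⟨_⟩ : ∀ {f} → Saturated f → QElem
  ⟨_⟩ {f} sf = record
    { D         = Shadow f
    ; saturated = λ v w (vv , v≤f) vw v∼w → vw , sf (v , vv) (w , vw) v∼w v≤f
    ; isShadow  = f , λ v → mk⇔ id id
    }

  kernelQ : Carrier → QElem
  kernelQ g = ⟨ saturated-kernel g ⟩

  _∨Q_ _∧Q_ : QElem → QElem → QElem
  A ∨Q B = ⟨ saturated-∨ (saturated-face A) (saturated-face B) ⟩
  A ∧Q B = ⟨ saturated-∧ (saturated-face A) (saturated-face B) ⟩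

  𝟎Q 𝟏Q : QElem
  𝟎Q = ⟨ saturated-𝟎 ⟩
  𝟏Q = ⟨ saturated-𝟏 ⟩

  isLatticeQ : IsLattice _≈Q_ _≤Q_ _∨Q_ _∧Q_
  isLatticeQ = record
    { isPartialOrder = isPartialOrderQ
    ; supremum = λ A B →
        ⊑⇒≤Q {A} {A ∨Q B} (≤⇒⊑ (x≤x∨y _ _)) ,
        ⊑⇒≤Q {B} {A ∨Q B} (≤⇒⊑ (y≤x∨y _ _)) ,
        λ C A≤C B≤C → ⊑⇒≤Q {A ∨Q B} {C} (∨-⊑ (≤Q⇒⊑ {A} {C} A≤C) (≤Q⇒⊑ {B} {C} B≤C))
    ; infimum = λ A B →
        ⊑⇒≤Q {A ∧Q B} {A} (≤⇒⊑ (x∧y≤x _ _)) ,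
        ⊑⇒≤Q {A ∧Q B} {B} (≤⇒⊑ (x∧y≤y _ _)) ,
        λ C C≤A C≤B → ⊑⇒≤Q {C} {A ∧Q B} λ v v∈ →
          ∧-greatest (≤Q⇒⊑ {C} {A} C≤A v v∈) (≤Q⇒⊑ {C} {B} C≤B v v∈)
    }

  finiteQ : QN.Finite
  finiteQ = map kernelQ (proj₁ finite) , λ A →
    Any.map⁺ (Any.map (λ {g} e → ≤Q-antisym {A} {kernelQ g}
        (⊑⇒≤Q {A} {kernelQ g} (⊑kernel (saturated-face A) (≤⇒⊑ (reflexive e))))
        (⊑⇒≤Q {kernelQ g} {A} (⊑-trans (kernel⊑ g) (≤⇒⊑ (reflexive (Eq.sym e))))))
      (proj₂ finite (face A)))

  -- The isomorphism as a relation up to equality of shadows, because shadows determine faces of `M`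
  -- only up to double negation.
  Corresponds : QElem → Carrier → Set
  Corresponds A t = (face A ∨ N) ≃ t

  rankN : QElem → ℕ
  rankN A = ρ (face A ∨ N)

  ρQ : QElem → ℕ
  ρQ A = rankN A ∸ ρ N

  -- The truncated subtraction in `ρQ` is exact because `N` lies below `face A ∨ N`.
  ρQ+ρN : ∀ A → ρQ A ℕ.+ ρ N ≡ rankN A
  ρQ+ρN A = ℕ.m∸n+n≡m (classically (_ ℕ.≤? _) λ dec → Classical.ρ-mono dec (y≤x∨y (face A) N))

  corresponds-refl : ∀ A → Corresponds A (face A ∨ N)
  corresponds-refl A = (λ _ → id) , (λ _ → id)

  corresponds-kernel : ∀ {t} → N ⊑ t → Corresponds (kernelQ t) t
  corresponds-kernel = kernel∨N

  corresponds-rank : ∀ {A t} → Corresponds A t → rankN A ≡ ρ t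
  corresponds-rank = ρ-cong-≃

  corresponds-ρQ : ∀ {A t} → Corresponds A t → ρQ A ≡ ρ t ∸ ρ N
  corresponds-ρQ cor = ≡.cong (_∸ ρ N) (ρ-cong-≃ cor)

  corresponds-reflects : ∀ {A B s t} → Corresponds A s → Corresponds B t → s ⊑ t → A ≤Q B
  corresponds-reflects {A} {B} (As , _) (_ , tB) s⊑t = ⊑⇒≤Q {A} {B}
    (⊑∨N⇒⊑ (saturated-face A) (saturated-face B)
      (⊑-trans (≤⇒⊑ (x≤x∨y _ _)) (⊑-trans As (⊑-trans s⊑t tB))))

  ∨N-mono : ∀ {A B} → A ≤Q B → (face A ∨ N) ⊑ (face B ∨ N)
  ∨N-mono {A} {B} A≤B = ∨-⊑ (⊑-trans (≤Q⇒⊑ {A} {B} A≤B) (≤⇒⊑ (x≤x∨y _ _))) (≤⇒⊑ (y≤x∨y _ _))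

  corresponds-mono : ∀ {A B s t} → Corresponds A s → Corresponds B t → A ≤Q B → s ⊑ t
  corresponds-mono {A} {B} (_ , sA) (Bt , _) A≤B = ⊑-trans sA (⊑-trans (∨N-mono {A} {B} A≤B) Bt)

  -- By `shadow-∨N`, a vertex common to `s` and `t` lies in `N` or in both saturated faces, so
  -- adding `N` commutes with meets.
  corresponds-∧ : ∀ {A B s t} → Corresponds A s → Corresponds B t → Corresponds (A ∧Q B) (s ∧ t)
  corresponds-∧ {A} {B} {s} {t} (As , sA) (Bt , tB) =
    (λ v v∈ → ∧-greatest (As v (meet-∨N v v∈ (x∧y≤x _ _))) (Bt v (meet-∨N v v∈ (x∧y≤y _ _)))) ,
    λ v v∈ → case shadow-∨N (saturated-face A) v (sA v (trans v∈ (x∧y≤x s t)))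
                , shadow-∨N (saturated-face B) v (tB v (trans v∈ (x∧y≤y s t))) of λ where
      (inj₂ nr , _) → trans (nonRep⇒∈N v nr) (y≤x∨y _ _)
      (inj₁ _ , inj₂ nr) → trans (nonRep⇒∈N v nr) (y≤x∨y _ _)
      (inj₁ v∈A , inj₁ v∈B) → trans (∧-greatest v∈A v∈B) (x≤x∨y _ _)
    where
    meet-∨N : ∀ {f g} v → v ∈ᶠ (f ∨ N) → f ≤ g → v ∈ᶠ (g ∨ N)
    meet-∨N v v∈ f≤g = trans v∈ (∨-least (trans f≤g (x≤x∨y _ _)) (y≤x∨y _ _))

  -- The kernel of a face strictly between `face A ∨ N` and `face B ∨ N` would lie strictly between
  -- `A` and `B`.
  rankN-⋖ : ∀ {A B} → A QN.⋖ B → rankN B ≡ suc (rankN A)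
  rankN-⋖ {A} {B} ((A≤B , A≉B) , none) = classically (_ ℕ.≟ _) λ dec →
    Classical.ρ-⋖ dec
      ( (⊑⇒≤ dec (∨N-mono {A} {B} A≤B)
        , λ e → A≉B (≤Q-antisym {A} {B} A≤B
                  (corresponds-reflects {B} {A} (corresponds-refl B) (corresponds-refl A) (≤⇒⊑ (reflexive (Eq.sym e))))))
      , λ t ((X≤t , X≉t) , t≤Z , t≉Z) →
          let cor = corresponds-kernel {t} (≤⇒⊑ (trans (y≤x∨y _ _) X≤t))
              C = kernelQ t
          in none C
            ( (corresponds-reflects {A} {C} (corresponds-refl A) cor (≤⇒⊑ X≤t)
              , λ e → X≉t (antisym X≤t (⊑⇒≤ dec
                  (corresponds-mono {C} {A} cor (corresponds-refl A) (≈Q⇒≥Q {A} {C} e)))))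
            , corresponds-reflects {C} {B} cor (corresponds-refl B) (≤⇒⊑ t≤Z)
            , λ e → t≉Z (antisym t≤Z (⊑⇒≤ dec
                (corresponds-mono {B} {C} (corresponds-refl B) cor (≈Q⇒≥Q {C} {B} e))))))

  rankN-chain : ∀ {A B k} → QN.MaxChain A B k → rankN B ≡ k ℕ.+ rankN A
  rankN-chain {A} {B} (QN.done e) = ρ-cong-≃
    (∨N-mono {B} {A} (≈Q⇒≥Q {A} {B} e) , ∨N-mono {A} {B} (≈Q⇒≤Q {A} {B} e))
  rankN-chain {A} {B} {suc k} (QN.step {m = C} A⋖C ch) = ≡.trans (rankN-chain ch)
    (≡.trans (≡.cong (k ℕ.+_) (rankN-⋖ {A} {C} A⋖C)) (ℕ.+-suc k _))

  rankN-𝟎Q : rankN 𝟎Q ≡ ρ N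
  rankN-𝟎Q = ρ-cong-≃ (≤⇒⊑ (∨-least (𝟎-least N) refl) , ≤⇒⊑ (y≤x∨y 𝟎 N))

  rankedQ : ∀ A k → QN.MaxChain 𝟎Q A k → ρQ A ≡ k
  rankedQ A k ch = ≡.trans
    (≡.cong (_∸ ρ N) (≡.trans (rankN-chain ch) (≡.cong (k ℕ.+_) rankN-𝟎Q))) (ℕ.m+n∸n≡m k (ρ N))

  -- Diamond property and connectedness for intervals of `M/∼`.

  module Interval (A B : QElem) (A<B : A QN.< B) where
    X Z : Carrier
    X = face A ∨ N
    -- Joining with `X` makes `X ≤ Z` hold in the order of `M`, whereas `A ≤Q B` compares only
    -- shadows. The shadow is still that of `face B ∨ N`.
    Z = X ∨ (face B ∨ N)

    A≤B : A ≤Q B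
    A≤B = proj₁ A<B

    B↔Z : Corresponds B Z
    B↔Z = ≤⇒⊑ (y≤x∨y _ _) , ∨-⊑ (∨N-mono {A} {B} A≤B) (λ _ → id)

    A↔X : Corresponds A X
    A↔X = corresponds-refl A

    X<Z : X < Z
    X<Z = x≤x∨y _ _ , λ e → proj₂ A<B (≤Q-antisym {A} {B} A≤B
      (corresponds-reflects {B} {A} B↔Z A↔X (≤⇒⊑ (reflexive (Eq.sym e)))))

    N⊑ : ∀ {t} → X ≤ t → N ⊑ t
    N⊑ X≤t = ≤⇒⊑ (trans (y≤x∨y _ _) X≤t)

    kernel↔ : ∀ {t} → X ≤ t → Corresponds (kernelQ t) t
    kernel↔ X≤t = corresponds-kernel (N⊑ X≤t)

    -- A counterpart of `C` that is forced between `X` and `Z` in the order of `M`; for `C` between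
    -- `A` and `B` it has the shadow of `face C ∨ N`.
    lift : QElem → Carrier
    lift C = (X ∨ face C) ∧ Z

    X≤lift : ∀ C → X ≤ lift C
    X≤lift C = ∧-greatest (x≤x∨y _ _) (proj₁ X<Z)

    lift≤Z : ∀ C → lift C ≤ Z
    lift≤Z C = x∧y≤y _ _

    lift↔ : ∀ {C} → A ≤Q C → C ≤Q B → Corresponds C (lift C)
    lift↔ {C} A≤C C≤B =
      ∨-⊑ (λ v v∈ → ∧-greatest (trans v∈ (y≤x∨y _ _))
                      (proj₁ B↔Z v (trans (≤Q⇒⊑ {C} {B} C≤B v v∈) (x≤x∨y _ _))))
          (N⊑ (X≤lift C)) ,
      ⊑-trans (≤⇒⊑ (x∧y≤x _ _)) (∨-⊑ (∨N-mono {A} {C} A≤C) (≤⇒⊑ (x≤x∨y _ _)))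

    <lift : ∀ {C} → A QN.< C → C ≤Q B → X < lift C
    <lift {C} (A≤C , A≉C) C≤B = X≤lift C , λ e → A≉C (≤Q-antisym {A} {C} A≤C
      (corresponds-reflects {C} {A} (lift↔ {C} A≤C C≤B) A↔X (≤⇒⊑ (reflexive (Eq.sym e)))))

    lift< : ∀ {C} → A ≤Q C → C QN.< B → lift C < Z
    lift< {C} A≤C (C≤B , C≉B) = lift≤Z C , λ e → C≉B (≤Q-antisym {C} {B} C≤B
      (corresponds-reflects {B} {C} B↔Z (lift↔ {C} A≤C C≤B) (≤⇒⊑ (reflexive (Eq.sym e)))))

    kernel≤ : ∀ {t} → X ≤ t → t ≤ Z → A ≤Q kernelQ t × kernelQ t ≤Q B
    kernel≤ {t} X≤t t≤Z = corresponds-reflects {A} {kernelQ t} A↔X (kernel↔ X≤t) (≤⇒⊑ X≤t) ,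
                          corresponds-reflects {kernelQ t} {B} (kernel↔ X≤t) B↔Z (≤⇒⊑ t≤Z)

    kernel< : ∀ {t} → X < t → t < Z → A QN.< kernelQ t × kernelQ t QN.< B
    kernel< {t} (X≤t , X≉t) (t≤Z , t≉Z) = let A≤K , K≤B = kernel≤ X≤t t≤Z in
      (A≤K , λ e → ≉⇒≄ X≉t (≤⇒⊑ X≤t ,
        corresponds-mono {kernelQ t} {A} (kernel↔ X≤t) A↔X (≈Q⇒≥Q {A} {kernelQ t} e))) ,
      (K≤B , λ e → ≉⇒≄ t≉Z (≤⇒⊑ t≤Z ,
        corresponds-mono {B} {kernelQ t} B↔Z (kernel↔ X≤t) (≈Q⇒≥Q {kernelQ t} {B} e)))

    ≃⇒≈Q : ∀ {C E s t} → Corresponds C s → Corresponds E t → s ≃ t → C ≈Q E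
    ≃⇒≈Q {C} {E} C↔s E↔t (s⊑t , t⊑s) = ≤Q-antisym {C} {E}
      (corresponds-reflects {C} {E} C↔s E↔t s⊑t) (corresponds-reflects {E} {C} E↔t C↔s t⊑s)

    ≈Q⇒≃ : ∀ {C E s t} → Corresponds C s → Corresponds E t → C ≈Q E → s ≃ t
    ≈Q⇒≃ {C} {E} C↔s E↔t e =
      corresponds-mono {C} {E} C↔s E↔t (≈Q⇒≤Q {C} {E} e) ,
      corresponds-mono {E} {C} E↔t C↔s (≈Q⇒≥Q {C} {E} e)

    diamondQ : ρQ B ≡ 2 ℕ.+ ρQ A → QN.ExactlyTwoBetween A B
    diamondQ eq = case diamond X Z X<Z ρZ of λ where
        (y₁ , y₂ , (X<y₁ , y₁<Z) , (X<y₂ , y₂<Z) , y₁≉y₂ , only) →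
          let K₁↔ = kernel↔ (proj₁ X<y₁)
              K₂↔ = kernel↔ (proj₁ X<y₂)
          in kernelQ y₁ , kernelQ y₂ , kernel< X<y₁ y₁<Z , kernel< X<y₂ y₂<Z ,
             (λ e → ≉⇒≄ y₁≉y₂ (≈Q⇒≃ {kernelQ y₁} {kernelQ y₂} K₁↔ K₂↔ e)) ,
             λ C A<C C<B →
               let C↔ = lift↔ {C} (proj₁ A<C) (proj₁ C<B) in
               ⊎.map (≃⇒≈Q {C} {kernelQ y₁} C↔ K₁↔ ∘ ≈⇒≃) (≃⇒≈Q {C} {kernelQ y₂} C↔ K₂↔ ∘ ≈⇒≃)
                     (only (lift C) (<lift {C} A<C (proj₁ C<B)) (lift< {C} (proj₁ A<C) C<B))
      where
      ρZ : ρ Z ≡ 2 ℕ.+ ρ X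
      ρZ = ≡.trans (≡.sym (corresponds-rank {B} B↔Z)) (≡.trans (≡.sym (ρQ+ρN B))
             (≡.trans (≡.cong (ℕ._+ ρ N) eq) (≡.cong (2 ℕ.+_) (ρQ+ρN A))))

    ∸-commutes : ∀ m n k → (m ∸ n) ∸ k ≡ (m ∸ k) ∸ n
    ∸-commutes m n k = ≡.trans (ℕ.∸-+-assoc m n k)
      (≡.trans (≡.cong (m ∸_) (ℕ.+-comm n k)) (≡.sym (ℕ.∸-+-assoc m k n)))

    ρQ-codim : ∀ {C t} k → Corresponds C t → ρ t ≡ ρ Z ∸ k → ρQ C ≡ ρQ B ∸ k
    ρQ-codim {C} k C↔t eq = ≡.trans (corresponds-ρQ {C} C↔t) (≡.trans (≡.cong (_∸ ρ N) eq)
      (≡.trans (∸-commutes (ρ Z) k (ρ N)) (≡.cong (_∸ k) (≡.sym (corresponds-ρQ {B} B↔Z)))))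

    NodeQ : QElem → Set
    NodeQ C = A ≤Q C × C ≤Q B × ρQ C ≡ ρQ B ∸ 1

    AdjQ : QElem → QElem → Set
    AdjQ C E = ¬ (C ≈Q E) × ρQ (C ∧Q E) ≡ ρQ B ∸ 2

    walkQ : ∀ {a b C E} → Corresponds C a → Corresponds E b →
            Walk (ΛNode X Z) (ΛAdj Z) a b → QN.Walk NodeQ AdjQ C E
    walkQ {C = C} {E} C↔a E↔b (here a≈b) = QN.here (≃⇒≈Q {C} {E} C↔a E↔b (≈⇒≃ a≈b))
    walkQ {C = C} {E} C↔a E↔b (step {b = t} (X≤t , t≤Z , ρt) (a≉t , ρa∧t) w) =
      let K↔t = kernel↔ X≤t
          A≤K , K≤B = kernel≤ X≤t t≤Z
      in QN.step (A≤K , K≤B , ρQ-codim {kernelQ t} 1 K↔t ρt)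
                 ((λ e → ≉⇒≄ a≉t (≈Q⇒≃ {C} {kernelQ t} C↔a K↔t e)) ,
                  ρQ-codim {C ∧Q kernelQ t} 2 (corresponds-∧ {C} {kernelQ t} C↔a K↔t) ρa∧t)
                 (walkQ {C = kernelQ t} {E} K↔t E↔b w)

    connectedQ : 2 ℕ.+ ρQ A ℕ.< ρQ B → QN.Connected NodeQ AdjQ
    connectedQ lt C E (A≤C , C≤B , ρC) (A≤E , E≤B , ρE) =
      walkQ {C = C} {E} (lift↔ {C} A≤C C≤B) (lift↔ {E} A≤E E≤B)
        (connected X Z X<Z gap (lift C) (lift E) (node {C} A≤C C≤B ρC) (node {E} A≤E E≤B ρE))
      where
      gap : 2 ℕ.+ ρ X ℕ.< ρ Z
      gap = ≡.subst₂ ℕ._<_ (≡.cong (2 ℕ.+_) (ρQ+ρN A)) (≡.trans (ρQ+ρN B) (corresponds-rank {B} B↔Z))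
              (ℕ.+-monoˡ-< (ρ N) lt)
      node : ∀ {F} → A ≤Q F → F ≤Q B → ρQ F ≡ ρQ B ∸ 1 → ΛNode X Z (lift F)
      node {F} A≤F F≤B ρF = X≤lift F , lift≤Z F ,
        ≡.trans (≡.sym (corresponds-rank {F} (lift↔ {F} A≤F F≤B))) (≡.trans (≡.sym (ρQ+ρN F))
        (≡.trans (≡.cong (ℕ._+ ρ N) ρF)
        -- By `lt` the rank of `B` is positive, so subtracting one commutes with adding `ρ N`.
        (≡.trans (≡.sym (ℕ.+-∸-comm (ρ N) (ℕ.≤-trans (s≤s z≤n) lt)))
        (≡.cong (_∸ 1) (≡.trans (ρQ+ρN B) (corresponds-rank {B} B↔Z))))))

  cpmQ : IsCPM M/∼
  cpmQ = record
    { finite     = finiteQ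
    ; _∨_        = _∨Q_
    ; _∧_        = _∧Q_
    ; isLattice  = isLatticeQ
    ; 𝟎          = 𝟎Q
    ; 𝟏          = 𝟏Q
    ; 𝟎-least    = λ A → ⊑⇒≤Q {𝟎Q} {A} (≤⇒⊑ (𝟎-least (face A)))
    ; 𝟏-greatest = λ A → ⊑⇒≤Q {A} {𝟏Q} (≤⇒⊑ (𝟏-greatest (face A)))
    ; ρ          = ρQ
    ; ranked     = rankedQ
    ; diamond    = Interval.diamondQ
    ; connected  = Interval.connectedQ
    }

-- The vertices of `M/∼`, and primitivity.

module QuotientVertices (M : Poset 0ℓ 0ℓ 0ℓ) (cM : IsCPM M) (proper : IsCPM.Proper cM) where
  open Poset M using (Carrier; _≈_; _≤_; reflexive; trans; module Eq)
  open IsCPM cM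
  open IsLattice isLattice using (x≤x∨y; y≤x∨y; x∧y≤x)
  open CPMBasics M cM
  open ProperCPM M cM proper
  open QuotientCPM M cM proper
  open Quotient M cM
  open QElem
  open IsCPM cpmQ using () renaming
    (IsVertex to IsVertexQ; IsAutomorphism to IsAutomorphismQ;
     ActsAsTransposition to ActsAsTranspositionQ; Primitive to PrimitiveQ)
  module DQ = DecidableCPM M/∼ cpmQ ≤Q?

  classQ : Vertex → QElem
  classQ v = ⟨ saturated-cl v ⟩

  classQ-≤ : ∀ {v A} → v ∈ᶠ face A → classQ v ≤Q A
  classQ-≤ {v} {A} v∈A = ⊑⇒≤Q {classQ v} {A} (cl⊑ {v} (saturated-face A) v∈A)

  v∈cl : ∀ v → v ∈ᶠ cl v
  v∈cl v = ∼⇒∈cl {v} {v} (inj₁ Eq.refl)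

  classQ-∈ : ∀ {v A} → classQ v ≤Q A → v ∈ᶠ face A
  classQ-∈ {v} {A} le = ≤Q⇒⊑ {classQ v} {A} le v (v∈cl v)

  -- A saturated face inside the class of `v` that has any vertex contains the whole class; so
  -- `classQ v` covers `𝟎Q`.
  classQ-vertex : ∀ v → IsVertexQ (classQ v)
  classQ-vertex v = CPMBasics.ρ⇒vertex M/∼ cpmQ {classQ v} (≡.trans
    (≡.cong (_∸ ρ N) (≡.trans (rankN-⋖ {𝟎Q} {classQ v} 𝟎⋖) (≡.cong suc rankN-𝟎Q)))
    (ℕ.m+n∸n≡m 1 (ρ N)))
    where
    𝟎⋖ : 𝟎Q QN.⋖ classQ v
    𝟎⋖ = (⊑⇒≤Q {𝟎Q} {classQ v} (≤⇒⊑ (𝟎-least _)) ,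
          λ e → ∉𝟎 v (classQ-∈ {v} {𝟎Q} (≈Q⇒≥Q {𝟎Q} {classQ v} e))) ,
      λ C ((𝟎≤C , 𝟎≉C) , C≤cl , C≉cl) → 𝟎≉C (≤Q-antisym {𝟎Q} {C} 𝟎≤C (⊑⇒≤Q {C} {𝟎Q} λ w w∈C →
        ⊥-elim (C≉cl (≤Q-antisym {C} {classQ v} C≤cl (classQ-≤ {v} {C}
          (saturated-face C w v (∼-sym (∈cl⇒∼ {v} {w} (≤Q⇒⊑ {C} {classQ v} C≤cl w w∈C))) w∈C))))))

  vertexQ⇒classQ≈ : ∀ {v A} → IsVertexQ A → v ∈ᶠ face A → classQ v ≈Q A
  vertexQ⇒classQ≈ {v} {A} vA v∈A =
    DQ.vertex-≤⇒≈ {classQ v} {A} (classQ-vertex v) vA (classQ-≤ {v} {A} v∈A)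

  -- Without vertices `A` would lie below `𝟎Q`; membership being decidable, a search through the
  -- finite list of vertices yields a witness.
  vertexQ-inhabited : ∀ {A} → IsVertexQ A → ∃ λ v → v ∈ᶠ face A
  vertexQ-inhabited {A} vA =
    let v , ¬¬v∈A = ¬∀⇒∃¬ {S = λ v → ¬ (v ∈ᶠ face A)}
                      (λ _ _ v≈w v∉A w∈A → v∉A (trans (reflexive v≈w) w∈A))
                      (λ v → ¬? (v ∈ᶠ? face A))
                      (λ empty → DQ.<⇒≱ {𝟎Q} {A} (DQ.𝟎<vertex {A} vA)
                        (⊑⇒≤Q {A} {𝟎Q} λ v v∈A → ⊥-elim (empty v v∈A)))
    in v , decidable-stable (v ∈ᶠ? face A) ¬¬v∈A

  -- Replacing in a face a vertex `a` of `X` by a vertex `b` of `Y`.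

  module SwapFaces (dec : ∀ x y → Dec (x ≤ y)) {X Y : QElem} (vX : IsVertexQ X) (vY : IsVertexQ Y)
                   (X≉Y : ¬ (X ≈Q Y)) {ψ : QElem → QElem} (aut : IsAutomorphismQ ψ)
                   (act : ActsAsTranspositionQ ψ X Y) {a b : Vertex}
                   (a∈X : a ∈ᶠ face X) (b∈Y : b ∈ᶠ face Y) where
    module T = DQ.Transposition {X} {Y} vX vY X≉Y {ψ} aut act

    a≁b : ¬ (a ∼ᵛ b)
    a≁b a∼b = X≉Y (DQ.vertex-≤⇒≈ {X} {Y} vX vY λ v v∈X →
      classQ-≤ {a} {Y} (saturated-face Y b a (∼-sym a∼b) b∈Y) v
        (≈Q⇒≥Q {classQ a} {X} (vertexQ⇒classQ≈ {a} {X} vX a∈X) v v∈X))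

    ≈X⇒a∼ : ∀ v → classQ v ≈Q X → a ∼ᵛ v
    ≈X⇒a∼ v e = ∼-sym (∈cl⇒∼ {v} {a} (≤Q⇒⊑ {X} {classQ v} (≈Q⇒≥Q {classQ v} {X} e) a a∈X))

    ≈Y⇒b∼ : ∀ v → classQ v ≈Q Y → b ∼ᵛ v
    ≈Y⇒b∼ v e = ∼-sym (∈cl⇒∼ {v} {b} (≤Q⇒⊑ {Y} {classQ v} (≈Q⇒≥Q {classQ v} {Y} e) b b∈Y))

    module _ (f : Carrier) (a∈f : a ∈ᶠ f) (b∉f : ¬ (b ∈ᶠ f)) where

      Swapped : Vertex → Set
      Swapped u = (u ∈ᶠ f × ¬ (u ≈ᵛ a)) ⊎ u ≈ᵛ b

      swapped? : ∀ u → Dec (Swapped u)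
      swapped? u = ((u ∈ᶠ? f) ×-dec ¬? (u ≈ᵛ? a)) ⊎-dec (u ≈ᵛ? b)

      swapped-resp : Respects≈ Swapped
      swapped-resp _ _ v≈w (inj₁ (v∈f , v≉a)) =
        inj₁ (trans (reflexive (Eq.sym v≈w)) v∈f , v≉a ∘ Eq.trans v≈w)
      swapped-resp _ _ v≈w (inj₂ v≈b) = inj₂ (Eq.trans (Eq.sym v≈w) v≈b)

      Y≰kernel : ¬ (Y ≤Q kernelQ f)
      Y≰kernel le = b∉f (kernel⊑ f b (≤Q⇒⊑ {Y} {kernelQ f} le b b∈Y))

      -- All classes in `f` except `X`. If `X` is among them it is deleted by the meet with the
      -- image under `ψ`, as `b ∉ f` keeps `Y` out of the kernel.
      kernel∖X : ∃ λ G → G ≤Q kernelQ f × ¬ (X ≤Q G) ×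
                   (∀ v → v ∈ᶠ kernel f → ¬ (a ∼ᵛ v) → v ∈ᶠ face G)
      kernel∖X with ≤Q? X (kernelQ f)
      ... | no X≰K = kernelQ f , (λ _ → id) , X≰K , λ v v∈K _ → v∈K
      ... | yes _ = K ∧Q ψ K , ⊑⇒≤Q {K ∧Q ψ K} {K} (≤⇒⊑ (x∧y≤x _ _)) ,
          T.meet-removes {K} Y≰kernel ,
          λ v v∈K a≁v → classQ-∈ {v} {K ∧Q ψ K}
            (T.meet-keeps {K} {classQ v} Y≰kernel (classQ-vertex v) (classQ-≤ {v} {K} v∈K)
              (a≁v ∘ ≈X⇒a∼ v))
        where K = kernelQ f

      G : QElem
      G = proj₁ kernel∖X

      X≰G : ¬ (X ≤Q G)
      X≰G = proj₁ (proj₂ (proj₂ kernel∖X))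

      G⊑kernel : face G ⊑ kernel f
      G⊑kernel = ≤Q⇒⊑ {G} {kernelQ f} (proj₁ (proj₂ kernel∖X))

      Y≰G : ¬ (Y ≤Q G)
      Y≰G Y≤G = Y≰kernel λ v v∈Y → proj₁ (proj₂ kernel∖X) v (Y≤G v v∈Y)

      G⊆Swapped : ∀ v → v ∈ᶠ face G → Swapped v
      G⊆Swapped v v∈G = inj₁ (kernel⊑ f v (G⊑kernel v v∈G) , λ v≈a → X≰G λ w w∈X →
        classQ-≤ {a} {G} (trans (reflexive (Eq.sym v≈a)) v∈G) w
          (≈Q⇒≥Q {classQ a} {X} (vertexQ⇒classQ≈ {a} {X} vX a∈X) w w∈X))

      ClassIn : Vertex → Vertex → Set
      ClassIn u w = u ∼ᵛ w → Swapped w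

      classIn? : ∀ u w → Dec (ClassIn u w)
      classIn? u w = (u ∼? w) →-dec swapped? w

      classIn-resp : ∀ u → Respects≈ (ClassIn u)
      classIn-resp u v w v≈w k u∼w = swapped-resp v w v≈w
        (k (∼-sym (∼-respˡ (Eq.sym v≈w) (∼-sym u∼w))))

      -- The class of `u` misses `b`, the only vertex of `Swapped` outside `f`, so it lies in `f`;
      -- it misses `a`, which is not in `Swapped`, so it is not `X`.
      class⊆Swapped⇒∈G : ∀ u → (∀ w → ClassIn u w) → ¬ (b ∼ᵛ u) → u ∈ᶠ face G
      class⊆Swapped⇒∈G u all b≁u = proj₂ (proj₂ (proj₂ kernel∖X)) u
        (∈kernel u λ w w∈ → case all w (∈cl⇒∼ {u} {w} w∈) of λ where
          (inj₁ (w∈f , _)) → w∈f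
          (inj₂ w≈b) → ⊥-elim (b≁u (∼-respˡ w≈b (∼-sym (∈cl⇒∼ {u} {w} w∈)))))
        (λ a∼u → case all a (∼-sym a∼u) of λ where
          (inj₁ (_ , a≉a)) → a≉a Eq.refl
          (inj₂ a≈b) → a≁b (inj₁ a≈b))

      -- If the swap completes the class Y, then G ∪ Y must be a face: this is add-vertex in M/∼.
      swapped-kernel : ∃ λ H → (∀ v → v ∈ᶠ face H → Swapped v) ×
                         (∀ u → (∀ w → ClassIn u w) → u ∈ᶠ face H)
      swapped-kernel with ∀vertex? (classIn-resp b) (classIn? b)
      ... | no ¬b⊆ = G , G⊆Swapped , λ u all → class⊆Swapped⇒∈G u all λ b∼u →
          ¬b⊆ λ w b∼w → all w (∼-trans {u} {b} {w} (∼-sym b∼u) b∼w)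
      ... | yes b⊆ = G ∨Q Y ,
          (λ v v∈ → case DQ.IsPyramid.vertices pyramidY (classQ v) (classQ-vertex v)
                           (classQ-≤ {v} {G ∨Q Y} v∈) of λ where
            (inj₁ v≤G) → G⊆Swapped v (classQ-∈ {v} {G} v≤G)
            (inj₂ v≈Y) → b⊆ v (≈Y⇒b∼ v v≈Y)) ,
          λ u all → case b ∼? u of λ where
            (yes b∼u) → trans (saturated-face Y b u b∼u b∈Y) (y≤x∨y _ _)
            (no b≁u) → trans (class⊆Swapped⇒∈G u all b≁u) (x≤x∨y _ _)
        where
        pyramidY : DQ.IsPyramid Y G
        pyramidY = DQ.Transposition.add-vertex {Y} {X} vY vX
          (λ e → X≉Y (≤Q-antisym {X} {Y} (≈Q⇒≥Q {Y} {X} e) (≈Q⇒≤Q {Y} {X} e)))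
          {ψ} aut (CPMBasics.transposition-sym M/∼ cpmQ {ψ} {X} {Y} act) {G} Y≰G X≰G

      -- `H` is the union of the classes inside `Swapped`. Every other vertex of `Swapped` has an
      -- equivalent vertex outside `Swapped`, so it can be adjoined by `AddVertices`.
      swapped-face : ∃ λ g → ∀ u → u ∈ᶠ g ⇔ Swapped u
      swapped-face with swapped-kernel
      ... | H , H⊆S , S⊆H = face H ∨ ⋁ (map proj₁ L) , λ u → mk⇔ (to u) (from u)
        where
        L = filter swapped? vs
        S-in-L : ∀ {v} → v ∈ L → Swapped v
        S-in-L v∈ = proj₂ (∈-filter⁻ swapped? {xs = vs} v∈)
        partner : ∀ {v} → v ∈ L → Swapped v × (v ∈ᶠ face H ⊎ ∃ λ r → v ∼ᵛ r × ¬ Swapped r)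
        partner {v} v∈ with ∀vertex? (classIn-resp v) (classIn? v)
        ... | yes all = S-in-L v∈ , inj₁ (S⊆H v all)
        ... | no ¬all = S-in-L v∈ , inj₂
          (let r , ¬k = ¬∀⇒∃¬ (classIn-resp v) (classIn? v) ¬all
           in r , decidable-stable (v ∼? r) (λ v≁r → ¬k (⊥-elim ∘ v≁r)) , λ Sr → ¬k λ _ → Sr)
        to : ∀ u → u ∈ᶠ (face H ∨ ⋁ (map proj₁ L)) → Swapped u
        to u u∈ with AddVertices.shadow-∨⋁ dec Swapped swapped-resp (face H) L H⊆S partner u u∈
        ... | inj₁ u∈H = H⊆S u u∈H
        ... | inj₂ (w , w∈L , u≈w) = swapped-resp w u (Eq.sym u≈w) (S-in-L w∈L)
        from : ∀ u → Swapped u → u ∈ᶠ (face H ∨ ⋁ (map proj₁ L))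
        from u Su = let w , w∈vs , u≈w = covers u in trans (reflexive u≈w) (trans
          (⋁-upper (∈-map⁺ proj₁ (∈-filter⁺ swapped? w∈vs (swapped-resp u w u≈w Su)))) (y≤x∨y _ _))

  -- Lifting a transposition of `M/∼` to `M`.

  module LiftTransposition (dec : ∀ x y → Dec (x ≤ y)) {X Y : QElem}
                   (vX : IsVertexQ X) (vY : IsVertexQ Y) (X≉Y : ¬ (X ≈Q Y)) {ψ : QElem → QElem} (aut : IsAutomorphismQ ψ)
                   (act : ActsAsTranspositionQ ψ X Y) {a b : Vertex}
                   (a∈X : a ∈ᶠ face X) (b∈Y : b ∈ᶠ face Y) where
    open SwapFaces dec {X} {Y} vX vY X≉Y {ψ} aut act {a} {b} a∈X b∈Y using (a≁b; swapped-face)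

    a≉b : ¬ (a ≈ᵛ b)
    a≉b = a≁b ∘ inj₁

    τ : Vertex → Vertex
    τ u with u ≈ᵛ? a | u ≈ᵛ? b
    ... | yes _ | _     = b
    ... | no _  | yes _ = a
    ... | no _  | no _  = u

    τ-a : ∀ {u} → u ≈ᵛ a → τ u ≡ b
    τ-a {u} u≈a with u ≈ᵛ? a | u ≈ᵛ? b
    ... | yes _ | _ = ≡.refl
    ... | no u≉a | _ = ⊥-elim (u≉a u≈a)

    τ-b : ∀ {u} → u ≈ᵛ b → τ u ≡ a
    τ-b {u} u≈b with u ≈ᵛ? a | u ≈ᵛ? b
    ... | yes u≈a | _ = ⊥-elim (a≉b (Eq.trans (Eq.sym u≈a) u≈b))
    ... | no _ | yes _ = ≡.refl
    ... | no _ | no u≉b = ⊥-elim (u≉b u≈b)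

    τ-other : ∀ {u} → ¬ (u ≈ᵛ a) → ¬ (u ≈ᵛ b) → τ u ≡ u
    τ-other {u} u≉a u≉b with u ≈ᵛ? a | u ≈ᵛ? b
    ... | yes u≈a | _ = ⊥-elim (u≉a u≈a)
    ... | no _ | yes u≈b = ⊥-elim (u≉b u≈b)
    ... | no _ | no _ = ≡.refl

    data Position (u : Vertex) : Set where
      at-a  : u ≈ᵛ a → Position u
      at-b  : u ≈ᵛ b → Position u
      other : ¬ (u ≈ᵛ a) → ¬ (u ≈ᵛ b) → Position u

    position : ∀ u → Position u
    position u with u ≈ᵛ? a | u ≈ᵛ? b
    ... | yes p | _     = at-a p
    ... | no _  | yes q = at-b q
    ... | no p  | no q  = other p q

    ≡⇒≈ᵛ : ∀ {u v} → u ≡ v → u ≈ᵛ v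
    ≡⇒≈ᵛ ≡.refl = Eq.refl

    τ-cong : ∀ {u v} → u ≈ᵛ v → τ u ≈ᵛ τ v
    τ-cong {u} {v} u≈v with position u
    ... | at-a p = ≡⇒≈ᵛ (≡.trans (τ-a {u} p) (≡.sym (τ-a {v} (Eq.trans (Eq.sym u≈v) p))))
    ... | at-b p = ≡⇒≈ᵛ (≡.trans (τ-b {u} p) (≡.sym (τ-b {v} (Eq.trans (Eq.sym u≈v) p))))
    ... | other p q = Eq.trans (≡⇒≈ᵛ (τ-other {u} p q)) (Eq.trans u≈v
            (≡⇒≈ᵛ (≡.sym (τ-other {v} (p ∘ Eq.trans u≈v) (q ∘ Eq.trans u≈v)))))

    τ-involutive : ∀ u → τ (τ u) ≈ᵛ u
    τ-involutive u with position u
    ... | at-a p = Eq.trans (≡⇒≈ᵛ (τ-b {τ u} (≡⇒≈ᵛ (τ-a {u} p)))) (Eq.sym p)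
    ... | at-b p = Eq.trans (≡⇒≈ᵛ (τ-a {τ u} (≡⇒≈ᵛ (τ-b {u} p)))) (Eq.sym p)
    ... | other p q = ≡⇒≈ᵛ (≡.trans (≡.cong τ (τ-other {u} p q)) (τ-other {u} p q))

    ∈-resp : ∀ {u v f} → u ≈ᵛ v → u ∈ᶠ f → v ∈ᶠ f
    ∈-resp u≈v = trans (reflexive (Eq.sym u≈v))

    private
      Y≉X : ¬ (Y ≈Q X)
      Y≉X e = X≉Y (≤Q-antisym {X} {Y} (≈Q⇒≥Q {Y} {X} e) (≈Q⇒≤Q {Y} {X} e))

      to-τ : ∀ f → (a ∈ᶠ f → b ∈ᶠ f) → (b ∈ᶠ f → a ∈ᶠ f) → ∀ u → u ∈ᶠ f → τ u ∈ᶠ f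
      to-τ f ab ba u u∈f with position u
      ... | at-a p = ∈-resp {b} {τ u} (≡⇒≈ᵛ (≡.sym (τ-a {u} p))) (ab (∈-resp {u} {a} p u∈f))
      ... | at-b p = ∈-resp {a} {τ u} (≡⇒≈ᵛ (≡.sym (τ-b {u} p))) (ba (∈-resp {u} {b} p u∈f))
      ... | other p q = ∈-resp {u} {τ u} (≡⇒≈ᵛ (≡.sym (τ-other {u} p q))) u∈f

      invariant : ∀ f → (a ∈ᶠ f → b ∈ᶠ f) → (b ∈ᶠ f → a ∈ᶠ f) → ∀ u → u ∈ᶠ f ⇔ τ u ∈ᶠ f
      invariant f ab ba u = mk⇔ (to-τ f ab ba u)
        λ τu∈f → ∈-resp {τ (τ u)} {u} (τ-involutive u) (to-τ f ab ba (τ u) τu∈f)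

    -- `τ` preserves the shadow of a face that contains both or neither of `a` and `b`; in the
    -- remaining cases `swapped-face` supplies the image.
    image : ∀ f → ∃ λ g → ∀ u → u ∈ᶠ g ⇔ τ u ∈ᶠ f
    image f with a ∈ᶠ? f | b ∈ᶠ? f
    ... | yes a∈f | yes b∈f = f , invariant f (λ _ → b∈f) (λ _ → a∈f)
    ... | no a∉f  | no b∉f  = f , invariant f (⊥-elim ∘ a∉f) (⊥-elim ∘ b∉f)
    ... | yes a∈f | no b∉f  =
      let g , spec = swapped-face f a∈f b∉f
      in g , λ u → mk⇔ (to u ∘ Equivalence.to (spec u)) (Equivalence.from (spec u) ∘ from u)
      where
      to : ∀ u → (u ∈ᶠ f × ¬ (u ≈ᵛ a)) ⊎ u ≈ᵛ b → τ u ∈ᶠ f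
      to u S with position u | S
      ... | at-a p | inj₁ (_ , u≉a) = ⊥-elim (u≉a p)
      ... | at-a p | inj₂ u≈b = ⊥-elim (a≉b (Eq.trans (Eq.sym p) u≈b))
      ... | at-b p | _ = ∈-resp {a} {τ u} (≡⇒≈ᵛ (≡.sym (τ-b {u} p))) a∈f
      ... | other p q | inj₁ (u∈f , _) = ∈-resp {u} {τ u} (≡⇒≈ᵛ (≡.sym (τ-other {u} p q))) u∈f
      ... | other p q | inj₂ u≈b = ⊥-elim (q u≈b)
      from : ∀ u → τ u ∈ᶠ f → (u ∈ᶠ f × ¬ (u ≈ᵛ a)) ⊎ u ≈ᵛ b
      from u τu∈f with position u
      ... | at-a p = ⊥-elim (b∉f (∈-resp {τ u} {b} (≡⇒≈ᵛ (τ-a {u} p)) τu∈f))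
      ... | at-b p = inj₂ p
      ... | other p q = inj₁ (∈-resp {τ u} {u} (≡⇒≈ᵛ (τ-other {u} p q)) τu∈f , p)
    ... | no a∉f  | yes b∈f =
      -- The same `ψ` serves with the roles of `X`, `a` and `Y`, `b` exchanged.
      let g , spec = SwapFaces.swapped-face dec {Y} {X} vY vX Y≉X {ψ} aut
            (CPMBasics.transposition-sym M/∼ cpmQ {ψ} {X} {Y} act) {b} {a} b∈Y a∈X f b∈f a∉f
      in g , λ u → mk⇔ (to u ∘ Equivalence.to (spec u)) (Equivalence.from (spec u) ∘ from u)
      where
      to : ∀ u → (u ∈ᶠ f × ¬ (u ≈ᵛ b)) ⊎ u ≈ᵛ a → τ u ∈ᶠ f
      to u S with position u | S
      ... | at-b p | inj₁ (_ , u≉b) = ⊥-elim (u≉b p)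
      ... | at-b p | inj₂ u≈a = ⊥-elim (a≉b (Eq.trans (Eq.sym u≈a) p))
      ... | at-a p | _ = ∈-resp {b} {τ u} (≡⇒≈ᵛ (≡.sym (τ-a {u} p))) b∈f
      ... | other p q | inj₁ (u∈f , _) = ∈-resp {u} {τ u} (≡⇒≈ᵛ (≡.sym (τ-other {u} p q))) u∈f
      ... | other p q | inj₂ u≈a = ⊥-elim (p u≈a)
      from : ∀ u → τ u ∈ᶠ f → (u ∈ᶠ f × ¬ (u ≈ᵛ b)) ⊎ u ≈ᵛ a
      from u τu∈f with position u
      ... | at-b p = ⊥-elim (a∉f (∈-resp {τ u} {a} (≡⇒≈ᵛ (τ-b {u} p)) τu∈f))
      ... | at-a p = inj₂ p
      ... | other p q = inj₁ (∈-resp {τ u} {u} (≡⇒≈ᵛ (τ-other {u} p q)) τu∈f , q)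

    φ : Carrier → Carrier
    φ f = proj₁ (image f)

    φ⁻ : ∀ {f} u → u ∈ᶠ φ f → τ u ∈ᶠ f
    φ⁻ {f} u = Equivalence.to (proj₂ (image f) u)

    φ⁺ : ∀ {f} u → τ u ∈ᶠ f → u ∈ᶠ φ f
    φ⁺ {f} u = Equivalence.from (proj₂ (image f) u)

    φ-involutive : ∀ f → φ (φ f) ≃ f
    φ-involutive f =
      (λ u u∈ → ∈-resp {τ (τ u)} {u} (τ-involutive u) (φ⁻ (τ u) (φ⁻ u u∈))) ,
      (λ u u∈ → φ⁺ u (φ⁺ (τ u) (∈-resp {u} {τ (τ u)} (Eq.sym (τ-involutive u)) u∈)))

    φ-⊑ : ∀ {f g} → f ⊑ g → φ f ⊑ φ g
    φ-⊑ f⊑g u u∈ = φ⁺ u (f⊑g (τ u) (φ⁻ u u∈))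

    φ-automorphism : IsAutomorphism φ
    φ-automorphism =
      (λ f g → mk⇔ (λ f≤g → ⊑⇒≤ dec (φ-⊑ (≤⇒⊑ f≤g)))
        (λ φf≤φg → ⊑⇒≤ dec (⊑-trans (proj₂ (φ-involutive f))
          (⊑-trans (φ-⊑ (≤⇒⊑ φf≤φg)) (proj₁ (φ-involutive g)))))) ,
      λ f → φ f , ≃⇒≈ dec (φ-involutive f)

    φ-vertex : ∀ v → φ (proj₁ v) ≈ proj₁ (τ v)
    φ-vertex v = ≃⇒≈ dec
      ((λ u u∈ → reflexive (Eq.trans (Eq.sym (τ-involutive u))
          (τ-cong {τ u} {v} (∈-vertex {τ u} {v} (φ⁻ u u∈))))) ,
       (λ u u∈ → φ⁺ u (reflexive (Eq.trans (τ-cong {u} {τ v} (∈-vertex {u} {τ v} u∈)) (τ-involutive v)))))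

    a∼b : a ∼ᵛ b
    a∼b = inj₂ (φ , φ-automorphism ,
      Eq.trans (φ-vertex a) (≡⇒≈ᵛ (τ-a {a} Eq.refl)) ,
      Eq.trans (φ-vertex b) (≡⇒≈ᵛ (τ-b {b} Eq.refl)) ,
      λ v vv v≉a v≉b → Eq.trans (φ-vertex (v , vv)) (≡⇒≈ᵛ (τ-other {v , vv} v≉a v≉b)))

    absurd : ⊥
    absurd = a≁b a∼b

  -- Equality in `M/∼` is decidable, so the order of `M` may be taken as decided and `X`, `Y` as
  -- distinct. The lifted transposition then makes `a` and `b` equivalent although they lie in
  -- different classes.
  primitiveQ : PrimitiveQ
  primitiveQ X Y vX vY (inj₁ X≈Y) = X≈Y
  primitiveQ X Y vX vY (inj₂ (ψ , aut , act)) =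
    let a , a∈X = vertexQ-inhabited {X} vX
        b , b∈Y = vertexQ-inhabited {Y} vY
    in decidable-stable (DQ._≈?_ X Y) λ X≉Y → ¬¬-decidable λ dec →
       LiftTransposition.absurd dec {X} {Y} vX vY X≉Y {ψ} aut act {a} {b} a∈X b∈Y

-- Lengths of lists without repetition.

module DistinctLists {a ℓ} (S : Setoid a ℓ) where
  open Setoid S

  Distinct : List Carrier → Set (a ⊔ ℓ)
  Distinct = AllPairs (λ x y → ¬ (x ≈ y))

  lookup-injective : ∀ {xs} → Distinct xs → ∀ i j → lookup xs i ≈ lookup xs j → i ≡ j
  lookup-injective (_ ∷ _)        zero    zero    _ = ≡.refl
  lookup-injective (x≉ ∷ _)       zero    (suc j) e = ⊥-elim (All.lookup x≉ (∈-lookup j) e)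
  lookup-injective (x≉ ∷ _)       (suc i) zero    e = ⊥-elim (All.lookup x≉ (∈-lookup i) (sym e))
  lookup-injective (_ ∷ distinct) (suc i) (suc j) e = ≡.cong suc (lookup-injective distinct i j e)

  -- Sending a position in `xs` to that of an equal entry of `ys` is injective, so the pigeonhole
  -- principle applies.
  distinct-length-≤ : ∀ {xs ys} → Distinct xs → (∀ {x} → x ∈ xs → Any (x ≈_) ys) →
                      length xs ℕ.≤ length ys
  distinct-length-≤ {xs} {ys} distinct cover = injective⇒≤ {f = λ i → Any.index (at i)} λ {i} {j} e →
    lookup-injective distinct i j (trans (Any.lookup-index (at i))
      (sym (≡.subst (λ k → lookup xs j ≈ lookup ys k) (≡.sym e) (Any.lookup-index (at j)))))
    where
    at : ∀ i → Any (lookup xs i ≈_) ys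
    at i = cover (∈-lookup i)

length-filter-split : ∀ {A : Set} {P : A → Set} (P? : ∀ x → Dec (P x)) xs →
                      length (filter P? xs) ℕ.+ length (filter (¬? ∘ P?) xs) ≡ length xs
length-filter-split P? [] = ≡.refl
length-filter-split P? (x ∷ xs) with P? x
... | yes _ = ≡.cong suc (length-filter-split P? xs)
... | no  _ = ≡.trans (ℕ.+-suc _ _) (≡.cong suc (length-filter-split P? xs))

-- Counting vertices and comparing the excess.

module QuotientExcess (M : Poset 0ℓ 0ℓ 0ℓ) (cM : IsCPM M) (proper : IsCPM.Proper cM) where
  open Poset M using (_≈_; reflexive; trans; module Eq)
  open IsCPM cM
  open IsLattice isLattice using (x≤x∨y; y≤x∨y; ∨-least)
  open CPMBasics M cM
  open ProperCPM M cM proper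
  open QuotientCPM M cM proper
  open QuotientVertices M cM proper
  open Quotient M cM
  open DistinctLists (Poset.Eq.setoid M/∼) using (distinct-length-≤)

  DistinctVertices : List Vertex → Set
  DistinctVertices = AllPairs λ v w → ¬ (v ≈ᵛ w)

  -- The list `vs` may repeat vertices, so the count uses an irredundant list. Its entries are added
  -- to `𝟎` in turn, each with its representative as partner.
  rank-N : ∀ {L} → DistinctVertices L → (∀ {v} → v ∈ L → NonRep v) →
           (∀ v → NonRep v → ∃ λ w → w ∈ L × v ≈ᵛ w) → ρ N ≡ length L
  rank-N {L} distinct nonRep complete = classically (_ ℕ.≟ _) λ dec → ≡.trans
    (ρ-cong-≃ N≃)
    (≡.trans
      (AddVertices.rank-∨⋁ dec NonRep nonRep-resp 𝟎 L (λ v v∈𝟎 → ⊥-elim (∉𝟎 v v∈𝟎)) distinct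
        λ {v} v∈L → nonRep v∈L , (rep v , ∼rep v , rep-isRep v) , ∉𝟎 v)
      (≡.trans (≡.cong (length L ℕ.+_) (Classical.ρ𝟎 dec)) (ℕ.+-identityʳ _)))
    where
    N≃ : N ≃ (𝟎 ∨ ⋁ (map proj₁ L))
    N≃ = (λ v v∈N → let w , w∈L , v≈w = complete v (∈N⇒nonRep v v∈N) in
            trans (reflexive v≈w) (trans (⋁-upper (∈-map⁺ proj₁ w∈L)) (y≤x∨y 𝟎 _))) ,
         ≤⇒⊑ (∨-least (𝟎-least N) (⋁-least (map proj₁ L) λ x∈ → case ∈-map⁻ proj₁ x∈ of λ where
            (v , v∈L , ≡.refl) → nonRep⇒∈N v (nonRep v∈L)))

  -- Distinct representatives have distinct classes, and every vertex of `M/∼` contains a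
  -- representative; each fact gives one inequality of lengths.
  number-of-classes : ∀ {L n′} → DistinctVertices L → (∀ {v} → v ∈ L → ¬ NonRep v) →
    (∀ v → ¬ NonRep v → ∃ λ w → w ∈ L × v ≈ᵛ w) → IsCPM.NumVertices cpmQ n′ → n′ ≡ length L
  number-of-classes {L} distinct isRep complete (Qs , ≡.refl , vQs , distinctQs , completeQs) =
    ℕ.≤-antisym
      (ℕ.≤-trans
        (distinct-length-≤ distinctQs λ {A} A∈Qs → Any.map⁺ (represented {A} (All.lookup vQs A∈Qs)))
        (ℕ.≤-reflexive (length-map classQ L)))
      (ℕ.≤-trans
        (ℕ.≤-reflexive (≡.sym (length-map classQ L)))
        (distinct-length-≤ (AllPairs.map⁺ (classes-distinct L distinct isRep))
          λ A∈ → case ∈-map⁻ classQ A∈ of λ where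
            (v , _ , ≡.refl) → completeQs (classQ v) (classQ-vertex v)))
    where
    represented : ∀ {A} → IsCPM.IsVertex cpmQ A → Any (λ v → A ≈Q classQ v) L
    represented {A} vA =
      let v , v∈A = vertexQ-inhabited {A} vA
          w , w∈L , r≈w = complete (rep v) (rep-isRep v)
          w∈A = saturated-face A (rep v) w (inj₁ r≈w) (saturated-face A v (rep v) (∼rep v) v∈A)
          e = vertexQ⇒classQ≈ {w} {A} vA w∈A
      in lose w∈L (≤Q-antisym {A} {classQ w} (≈Q⇒≥Q {classQ w} {A} e) (≈Q⇒≤Q {classQ w} {A} e))
    reps-related : ∀ {v w} → ¬ NonRep v → ¬ NonRep w → classQ v ≈Q classQ w → v ≈ᵛ w
    reps-related {v} {w} rv rw e =
      Eq.trans (decidable-stable (v ≈ᵛ? rep v) rv)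
        (Eq.trans (Eq.reflexive (≡.cong proj₁ (rep-cong {v} {w} (∼-sym
                    (∈cl⇒∼ {w} {v} (classQ-∈ {v} {classQ w} (≈Q⇒≤Q {classQ v} {classQ w} e)))))))
                  (Eq.sym (decidable-stable (w ≈ᵛ? rep w) rw)))
    classes-distinct : ∀ L → DistinctVertices L → (∀ {v} → v ∈ L → ¬ NonRep v) →
                       AllPairs (λ v w → ¬ (classQ v ≈Q classQ w)) L
    classes-distinct [] _ _ = []
    classes-distinct (v ∷ L) (v≉ ∷ distinct) isRep =
      All.tabulate (λ {w} w∈L e → All.lookup v≉ w∈L
        (reps-related {v} {w} (isRep (here ≡.refl)) (isRep (there w∈L)) e)) ∷
      classes-distinct L distinct (isRep ∘ there)

  private
    asVertices : ∀ {L} → All IsVertex L → ∃ λ (L′ : List Vertex) → map proj₁ L′ ≡ L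
    asVertices [] = [] , ≡.refl
    asVertices {x ∷ _} (vx ∷ vL) = let L′ , eq = asVertices vL in (x , vx) ∷ L′ , ≡.cong (x ∷_) eq

  number-of-vertices : ∀ {n n′} → NumVertices n → IsCPM.NumVertices cpmQ n′ → ρ N ℕ.+ n′ ≡ n
  number-of-vertices {n} {n′} (L₀ , ≡.refl , vL₀ , distinct₀ , complete₀) numQ =
    go (asVertices vL₀) distinct₀ complete₀
    where
    go : (∃ λ (L : List Vertex) → map proj₁ L ≡ L₀) → AllPairs (λ x y → ¬ (x ≈ y)) L₀ →
         (∀ v → IsVertex v → Any (v ≈_) L₀) → ρ N ℕ.+ n′ ≡ length L₀
    go (L , ≡.refl) distinct-map complete-map = ≡.trans
        (≡.cong₂ ℕ._+_
          (rank-N {filter nonRep? L} (AllPairs.filter⁺ nonRep? distinct)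
            (λ v∈ → proj₂ (∈-filter⁻ nonRep? {xs = L} v∈))
            (λ v nr → let w , w∈L , v≈w = complete v in
              w , ∈-filter⁺ nonRep? w∈L (nonRep-resp v w v≈w nr) , v≈w))
          (number-of-classes {filter rep? L} (AllPairs.filter⁺ rep? distinct)
            (λ v∈ → proj₂ (∈-filter⁻ rep? {xs = L} v∈))
            (λ v ¬nr → let w , w∈L , v≈w = complete v in
              w , ∈-filter⁺ rep? w∈L (λ nr → ¬nr (nonRep-resp w v (Eq.sym v≈w) nr)) , v≈w)
            numQ))
        (≡.trans (length-filter-split nonRep? L) (≡.sym (length-map proj₁ L)))
      where
      rep? : ∀ v → Dec (¬ NonRep v)
      rep? v = ¬? (nonRep? v)
      distinct : DistinctVertices L
      distinct = AllPairs.map⁻ distinct-map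
      complete : ∀ v → ∃ λ w → w ∈ L × v ≈ᵛ w
      complete (v , vv) = find (Any.map⁻ (complete-map v vv))

  -- Passing to `M/∼` lowers the number of vertices and the rank of the top by the same amount
  -- `ρ N`, which cancels.
  excessQ : ∀ n n′ → NumVertices n → IsCPM.NumVertices cpmQ n′ → IsCPM.excess cpmQ n′ ≡ excess n
  excessQ n n′ num numQ = ≡.trans (cancel (+ n′) (+ ρQ 𝟏Q) (+ ρ N))
    (≡.cong₂ (λ i j → + i ℤ.- (+ j ℤ.- + 2) ℤ.- + 2) (number-of-vertices num numQ)
      (≡.trans (ρQ+ρN 𝟏Q) (ρ-cong-≃ (≤⇒⊑ (𝟏-greatest _) , ≤⇒⊑ (x≤x∨y 𝟏 N)))))
    where
    cancel : ∀ i j k → i ℤ.- (j ℤ.- + 2) ℤ.- + 2 ≡ (k ℤ.+ i) ℤ.- ((j ℤ.+ k) ℤ.- + 2) ℤ.- + 2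
    cancel = solve 3 (λ i j k → i :- (j :- con (+ 2)) :- con (+ 2) :=
                                (k :+ i) :- ((j :+ k) :- con (+ 2)) :- con (+ 2)) ≡.refl
      where open +-*-Solver

theorem6p1 : (M : Poset 0ℓ 0ℓ 0ℓ) (cM : IsCPM M) → IsCPM.Proper cM →
    Σ (IsCPM (_/∼ M cM)) λ cQ →
    IsCPM.Primitive cQ ×
    (∀ n n′ → IsCPM.NumVertices cM n → IsCPM.NumVertices cQ n′ →
    IsCPM.excess cQ n′ ≡ IsCPM.excess cM n)
theorem6p1 M cM proper =
  QuotientCPM.cpmQ M cM proper ,
  QuotientVertices.primitiveQ M cM proper ,
  QuotientExcess.excessQ M cM proper
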